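{- Let $n=n_1n_2$ be a square-free odd integer which is divisible by neither $7$ nor $13$, where $n_1=\prod_{i=1}^r p_i$ and $n_2=\prod_{j=1}^s q_j$ with primes $p_i\equiv 1 \pmod 3$ and $q_j\equiv 2\pmod 3$. Let $S$ be a sequence over $\mathbb{Z}_n$ of length $\ell=D_{T_n}(\mathbb{Z}_n)-1=2\Omega(n_1)+\Omega(n_2)$ such that $S$ has no non-empty $T_n$-weighted zero-sum subsequence. Then $S$ is equivalent with respect to $T_n$ to a sequence $x_1\cdot x_2\cdots x_\ell$ for which one of the following holds: Case 1: There is a prime divisor $p$ of $n_1$ such that $p$ divides every term $x_i$ except exactly two, namely $x_1$ and $x_2$; writing $n'=n/p$ and $x_i=py_i$ for $3\le i\le \ell$ (with $y_i\in\mathbb{Z}_{n'}$), the sequence $y_3\cdot y_4\cdots y_\ell$ over $\mathbb{Z}_{n'}$ is a $T_{n'}$-extremal sequence in $\mathbb{Z}_{n'}$, and the image of $x_1\cdot x_2$ under the natural map $\mathbb{Z}_n\to\mathbb{Z}_p$ is $T_p$-extremal. Case 2: There is a prime divisor $p$ of $n_2$ such that $p$ divides every term $x_i$ except exactly one, namely $x_1$; writing $n'=n/p$ and $x_i=py_i$ for $2\le i\le\ell$, the sequence $y_2\cdot y_3\cdots y_\ell$ over $\mathbb{Z}_{n'}$ is a $T_{n'}$-extremal sequence in $\mathbb{Z}_{n'}$.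
   Context: $\mathbb{Z}_m=\mathbb{Z}/m\mathbb{Z}$, $\mathbb{Z}_m^*$ its unit group, and $T_m=\{a^3\bmod m: a\in\mathbb{Z}_m^*\}$ (the set of cubes of units). $\Omega(m)$ is the number of prime factors of $m$ counted with multiplicity. A sequence over $\mathbb{Z}_m$ is a finite unordered list (multiset) of elements of $\mathbb{Z}_m$; subsequences are sub-multisets. For a weight set $A\subseteq\mathbb{Z}_m$, a sequence $x_1\cdots x_k$ is an $A$-weighted zero-sum sequence if there are $a_1,\dots,a_k\in A$ with $\sum a_ix_i=0$ in $\mathbb{Z}_m$. $D_A(\mathbb{Z}_m)$ is the least positive integer $\ell$ such that every sequence over $\mathbb{Z}_m$ of length $\ell$ has a non-empty $A$-weighted zero-sum subsequence. An $A$-extremal sequence in $\mathbb{Z}_m$ is a sequence over $\mathbb{Z}_m$ of length $D_A(\mathbb{Z}_m)-1$ with no non-empty $A$-weighted zero-sum subsequence. For a subgroup $A$ of $\mathbb{Z}_m^*$, two sequences $x_1\cdots x_k$ and $y_1\cdots y_k$ over $\mathbb{Z}_m$ are equivalent with respect to $A$ if there are $a_1,\dots,a_k\in A$, $c\in\mathbb{Z}_m^*$ and a permutation $\sigma$ of $\{1,\dots,k\}$ with $y_i=c\,a_i\,x_{\sigma(i)}$ for all $i$. For a prime $p$, $D_{T_p}(\mathbb{Z}_p)=3$ if $p\equiv1\pmod 3$, so a $T_p$-extremal sequence then has length $2$. -}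

module Defs where

open import Data.Nat using (ℕ; zero; suc; _+_; _*_; _^_; _<_; _≤_)
open import Data.Nat.DivMod using (_%_)
open import Data.Nat.Divisibility using (_∣_)
open import Data.Nat.Coprimality using (Coprime)
open import Data.Nat.Primality using (Prime)
open import Data.List using (List; []; _∷_; length; zipWith; map)
open import Data.Nat.ListAction using (sum; product)
open import Data.List.Relation.Unary.All using (All)
open import Data.List.Relation.Binary.Sublist.Propositional using (_⊆_)
open import Data.List.Relation.Binary.Permutation.Propositional using (_↭_)
open import Data.List.Relation.Binary.Pointwise using (Pointwise)
open import Data.Product using (Σ; ∃; ∃-syntax; _×_)
open import Data.Sum using (_⊎_)
open import Relation.Nullary using (¬_)
open import Relation.Binary.PropositionalEquality using (_≡_; _≢_)

-- Residues of ℤ_m are represented by natural numbers 0 ≤ x < m.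
-- x mod m : reduction of x modulo m (total; m = 0 never used as a modulus).
_mod_ : ℕ → ℕ → ℕ
x mod zero = x
x mod suc k = x % suc k

-- a sequence over ℤ_m : a list of residues (order irrelevant)
SeqOver : ℕ → List ℕ → Set
SeqOver m S = All (_< m) S

Unit : ℕ → ℕ → Set
Unit m u = u < m × Coprime u m

InT : ℕ → ℕ → Set
InT m a = ∃[ b ] (Unit m b × a ≡ (b ^ 3) mod m)

WZeroSum : ℕ → List ℕ → Set
WZeroSum m S = ∃[ ws ] (length ws ≡ length S × All (InT m) ws
                        × (sum (zipWith _*_ ws S)) mod m ≡ 0)

HasWZSSub : ℕ → List ℕ → Set
HasWZSSub m S = ∃[ U ] (U ⊆ S × U ≢ [] × WZeroSum m U)

IsDT : ℕ → ℕ → Set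
IsDT m D = 1 ≤ D
         × (∀ S → SeqOver m S → length S ≡ D → HasWZSSub m S)
         × (∀ k → 1 ≤ k → k < D →
              ∃[ S ] (SeqOver m S × length S ≡ k × ¬ HasWZSSub m S))

Extremal : ℕ → List ℕ → Set
Extremal m S = SeqOver m S × ¬ HasWZSSub m S
             × ∃[ D ] (IsDT m D × suc (length S) ≡ D)

EquivT : ℕ → List ℕ → List ℕ → Set
EquivT m xs ys = ∃[ c ] (Unit m c × ∃[ zs ] (xs ↭ zs ×
                   Pointwise (λ z y → ∃[ a ] (InT m a × y ≡ (c * a * z) mod m)) zs ys))

SquareFree : ℕ → Set
SquareFree n = ∀ p → Prime p → ¬ (p * p ∣ n)

Case1 : ℕ → ℕ → List ℕ → Set
Case1 n n₁ xs = ∃[ p ] (Prime p × p ∣ n₁ × ∃[ n' ] (n ≡ p * n' ×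
                ∃[ x₁ ] ∃[ x₂ ] ∃[ rest ] (xs ≡ x₁ ∷ x₂ ∷ rest
                  × ¬ (p ∣ x₁) × ¬ (p ∣ x₂) × All (p ∣_) rest
                  × ∃[ ys ] (rest ≡ map (p *_) ys × Extremal n' ys)
                  × Extremal p (x₁ mod p ∷ x₂ mod p ∷ []))))

Case2 : ℕ → ℕ → List ℕ → Set
Case2 n n₂ xs = ∃[ p ] (Prime p × p ∣ n₂ × ∃[ n' ] (n ≡ p * n' ×
                ∃[ x₁ ] ∃[ rest ] (xs ≡ x₁ ∷ rest
                  × ¬ (p ∣ x₁) × All (p ∣_) rest
                  × ∃[ ys ] (rest ≡ map (p *_) ys × Extremal n' ys))))

{-# OPTIONS --safe #-}
module Submission where

-- By the Chinese remainder theorem a sequence over ℤ_n is a T_n-weighted zero-sum sequence as soon as its image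
-- over ℤ_p is one for every prime p ∣ n. Over ℤ_q with q ≡ 2 (mod 3) all units are cubes, and two terms prime to q
-- suffice for that; over ℤ_p with p ≡ 1 (mod 3) three terms prime to p suffice when p ≥ 19, because then
-- a x³ + b y³ + c z³ = 0 has a solution in units for all units a, b, c. So in a zero-sum free sequence some p divides
-- all but two terms (or some q all but one), and induction on the number of primes bounds the length of the
-- quotient sequence over ℤ_{n/p}; counting lengths then forces extremality.
--
-- For the ternary equation let T have index 3, f = |T|, and let g be a noncube. The number of solutions is governed by
-- the cyclotomic numbers A, B, C, D of order 3, which satisfy A + B + C + 1 = f and B + C + D = f, and, on comparing
-- two counts of the quadruples in T × T × gT × gT with equal differences, B² + C² + D² = f + AB + BC + CA.
-- These relations leave no room for a vanishing A, B, C or D once f ≥ 6.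

open import Defs
open import Algebra.Bundles using (CommutativeRing)
import Algebra.Solver.Ring
open import Algebra.Solver.Ring.AlmostCommutativeRing using (fromCommutativeRing; _-Raw-AlmostCommutative⟶_)
open import Algebra.Structures using (IsCommutativeRing)
open import Data.Bool using (if_then_else_)
open import Data.Empty using (⊥)
open import Data.Fin using (Fin; zero; suc; toℕ; fromℕ<; punchOut)
open import Data.Fin.Permutation using (permutation)
open import Data.Fin.Properties using (_≟_; any?; injective⇒≤; punchOut-injective; toℕ-fromℕ<; toℕ-injective; toℕ<n)
open import Data.Integer as ℤ using (ℤ; ∣_∣) renaming (+_ to pos)
open import Data.Integer.DivMod using (n%ℕd<d; a≡a%ℕn+[a/ℕn]*n; _%ℕ_; _/ℕ_)
import Data.Integer.Divisibility.Signed as ℤ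
import Data.Integer.Properties as ℤ
import Data.Integer.Solver
open import Data.List using (List; []; _∷_; _++_; length; filter; map; zipWith; take)
open import Data.List.Membership.Propositional using (_∈_; find)
open import Data.List.Membership.Propositional.Properties using (∈-∃++; ∈-++⁻; ∈-map⁻)
open import Data.List.Properties using (length-++; length-map; map-++; map-∘; map-id; length-take)
open import Data.List.Relation.Binary.Permutation.Propositional as ↭ using (_↭_; ↭-refl; ↭-sym; ↭-trans; ↭-prep)
open import Data.List.Relation.Binary.Permutation.Propositional.Properties using (All-resp-↭; ↭-length; shift)
import Data.List.Relation.Binary.Permutation.Propositional.Properties as ↭
open import Data.List.Relation.Binary.Pointwise using (Pointwise; []; _∷_)
open import Data.List.Relation.Binary.Sublist.Propositional using (_⊆_; []; _∷_; _∷ʳ_; ⊆-refl; ⊆-trans)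
open import Data.List.Relation.Binary.Sublist.Propositional.Properties using (take-⊆; ++⁺ˡ; map⁺)
open import Data.List.Relation.Unary.All as All using (All; []; _∷_)
import Data.List.Relation.Unary.All.Properties as All
import Data.List.Relation.Unary.Any as Any
open import Data.Maybe using (Maybe; just; nothing)
open import Data.Nat as ℕ using (ℕ; NonZero; _≤_; _<_; z≤n; s≤s; _^_)
open import Data.Nat.Coprimality as Coprime using (Coprime; coprime-Bézout; coprime-divisor; prime⇒coprime)
import Data.Nat.Divisibility as ℕ
open import Data.Nat.Divisibility using (_∣_; _∣?_)
open import Data.Nat.DivMod using (_%_; m%n<n; m<n⇒m%n≡m; [m+kn]%n≡m%n; m≡m%n+[m/n]*n)
open import Data.Nat.GCD using (module Bézout)
open import Data.Nat.ListAction using (product) renaming (sum to sumₗ)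
open import Data.Nat.ListAction.Properties using (sum-++; sum-↭; product-++; product-↭; ∈⇒∣product)
open import Data.Nat.Primality using (Prime; prime⇒nonZero; prime⇒nonTrivial; ¬prime[1]; irreducible[2]; productOfPrimes≢0)
import Data.Nat.Properties as ℕ
open import Data.Nat.Solver using () renaming (module +-*-Solver to ℕSolver)
open import Data.Product using (∃-syntax; _×_; _,_; proj₁; proj₂)
open import Data.Sum using (_⊎_; inj₁; inj₂)
open import Function using (_∘_; case_of_)
open import Relation.Binary.PropositionalEquality
open import Relation.Nullary using (¬_; Dec; yes; no; contradiction; does; ¬?; _×-dec_)
open import Relation.Nullary.Decidable using (decidable-stable)
open import Algebra.Properties.Semiring.Sum ℕ.+-*-semiring
  using (sum; sum-cong-≗; sum-permute; ∑-distrib-+; ∑-comm; *-distribˡ-sum; *-distribʳ-sum)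


-- The ring ℤ/p

-- The Chinese remainder theorem glues only weights of one and the same sequence, so a criterion at
-- p must give every term a unit weight; none may be dropped. Hence three terms prime to p are not
-- treated alone: two enter the ternary equation as they stand, and everything after the second
-- enters as one coefficient, with weights chosen to make its sum nonzero mod p. That choice is a
-- choice of sign, and it works because p is odd. The threshold 6 comes from a quadratic inequality.
-- D = A + 1 cannot vanish. If one of A, B, C does, the other two, m and n, satisfy m + n + 1 = f
-- and m² + n² ≤ m + n + mn, so m + n ≤ 4 and f ≤ 5. As p = 3f + 1 is odd, f is even, which leaves f
-- = 2 and f = 4: the excluded primes 7 and 13, where A is indeed 0. All counts are natural numbers;
-- neither characters nor Jacobi sums appear.

module Residues (p : ℕ) .{{_ : NonZero p}} where

  open Data.Integer.Solver.+-*-Solver using (solve; _:=_; _:+_; _:*_; _:-_; :-_)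

  opaque
    ⟦_⟧ : ℤ → Fin p
    ⟦ i ⟧ = fromℕ< (n%ℕd<d i p)

  lift : Fin p → ℤ
  lift x = pos (toℕ x)

  ∣-small⇒≡0 : ∀ {k} → k ℕ.< p → p ℕ.∣ k → k ≡ 0
  ∣-small⇒≡0 {ℕ.zero}  _   _   = refl
  ∣-small⇒≡0 {ℕ.suc k} k<p p∣k = contradiction p∣k (ℕ.>⇒∤ k<p)

  ∣m-n∣<p : ∀ {m n} → m ℕ.< p → n ℕ.< p → ∣ pos m ℤ.- pos n ∣ ℕ.< p
  ∣m-n∣<p {m} {n} m<p n<p = ℕ.≤-<-trans (ℕ.≤-reflexive (cong ∣_∣ (ℤ.m-n≡m⊖n m n))) (ℕ.≤-<-trans (ℤ.∣m⊝n∣≤m⊔n m n) (ℕ.⊔-pres-<m m<p n<p))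

  opaque
    unfolding ⟦_⟧

    lift-⟦⟧ : ∀ i → pos p ℤ.∣ lift ⟦ i ⟧ ℤ.- i
    lift-⟦⟧ i = ℤ.divides (ℤ.- (i /ℕ p)) (begin
      lift ⟦ i ⟧ ℤ.- i                                       ≡⟨ cong₂ ℤ._-_ (cong pos (toℕ-fromℕ< _)) (a≡a%ℕn+[a/ℕn]*n i p) ⟩
      pos (i %ℕ p) ℤ.- (pos (i %ℕ p) ℤ.+ (i /ℕ p) ℤ.* pos p)
        ≡⟨ solve 3 (λ r q n → r :- (r :+ q :* n) := (:- q) :* n) refl (pos (i %ℕ p)) (i /ℕ p) (pos p) ⟩
      ℤ.- (i /ℕ p) ℤ.* pos p                                   ∎)
      where open ≡-Reasoning

  -- Representatives in [0, p) differ by less than p in absolute value, so a difference divisible by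
  -- p is 0.
  lift-injective-mod : ∀ x y → pos p ℤ.∣ lift x ℤ.- lift y → x ≡ y
  lift-injective-mod x y d = toℕ-injective (ℤ.+-injective (ℤ.i-j≡0⇒i≡j (lift x) (lift y)
    (ℤ.∣i∣≡0⇒i≡0 (∣-small⇒≡0 (∣m-n∣<p (toℕ<n x) (toℕ<n y)) (ℤ.∣⇒∣ᵤ d)))))

  ⟦⟧-cong : ∀ i j → pos p ℤ.∣ i ℤ.- j → ⟦ i ⟧ ≡ ⟦ j ⟧
  ⟦⟧-cong i j d = lift-injective-mod ⟦ i ⟧ ⟦ j ⟧ (subst (pos p ℤ.∣_)
    (solve 4 (λ a b i j → (a :- i) :- (b :- j) :+ (i :- j) := a :- b) refl (lift ⟦ i ⟧) (lift ⟦ j ⟧) i j)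
    (ℤ.∣m∣n⇒∣m+n (ℤ.∣m∣n⇒∣m-n (lift-⟦⟧ i) (lift-⟦⟧ j)) d))

  ⟦⟧-cong⁻¹ : ∀ {i j} → ⟦ i ⟧ ≡ ⟦ j ⟧ → pos p ℤ.∣ i ℤ.- j
  ⟦⟧-cong⁻¹ {i} {j} eq = subst (pos p ℤ.∣_)
    (trans (cong (λ x → (lift ⟦ j ⟧ ℤ.- j) ℤ.- (lift x ℤ.- i)) eq)
      (solve 3 (λ b i j → (b :- j) :- (b :- i) := i :- j) refl (lift ⟦ j ⟧) i j))
    (ℤ.∣m∣n⇒∣m-n (lift-⟦⟧ j) (lift-⟦⟧ i))

  ⟦lift⟧ : ∀ x → ⟦ lift x ⟧ ≡ x
  ⟦lift⟧ x = lift-injective-mod _ x (lift-⟦⟧ (lift x))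

  infixl 6 _+_ _-_
  infixl 7 _*_
  infix  8 -_

  opaque
    _+_ _*_ : Fin p → Fin p → Fin p
    x + y = ⟦ lift x ℤ.+ lift y ⟧
    x * y = ⟦ lift x ℤ.* lift y ⟧

    -_ : Fin p → Fin p
    -_ x = ⟦ ℤ.- lift x ⟧

  _-_ : Fin p → Fin p → Fin p
  _-_ = λ x y → x + (- y)

  0# 1# : Fin p
  0# = ⟦ pos 0 ⟧
  1# = ⟦ pos 1 ⟧

  opaque
    unfolding _+_ _*_ -_

    +-homo : ∀ i j → ⟦ i ℤ.+ j ⟧ ≡ ⟦ i ⟧ + ⟦ j ⟧
    +-homo i j = sym (⟦⟧-cong (lift ⟦ i ⟧ ℤ.+ lift ⟦ j ⟧) (i ℤ.+ j) (subst (pos p ℤ.∣_)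
      (solve 4 (λ a b i j → (a :- i) :+ (b :- j) := (a :+ b) :- (i :+ j)) refl (lift ⟦ i ⟧) (lift ⟦ j ⟧) i j)
      (ℤ.∣m∣n⇒∣m+n (lift-⟦⟧ i) (lift-⟦⟧ j))))

    *-homo : ∀ i j → ⟦ i ℤ.* j ⟧ ≡ ⟦ i ⟧ * ⟦ j ⟧
    *-homo i j = sym (⟦⟧-cong (lift ⟦ i ⟧ ℤ.* lift ⟦ j ⟧) (i ℤ.* j) (subst (pos p ℤ.∣_)
      (solve 4 (λ a b i j → (a :- i) :* b :+ i :* (b :- j) := (a :* b) :- (i :* j)) refl (lift ⟦ i ⟧) (lift ⟦ j ⟧) i j)
      (ℤ.∣m∣n⇒∣m+n (ℤ.∣m⇒∣m*n (lift ⟦ j ⟧) (lift-⟦⟧ i)) (ℤ.∣n⇒∣m*n i (lift-⟦⟧ j)))))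

    -‿homo : ∀ i → ⟦ ℤ.- i ⟧ ≡ (- ⟦ i ⟧)
    -‿homo i = sym (⟦⟧-cong (ℤ.- lift ⟦ i ⟧) (ℤ.- i) (subst (pos p ℤ.∣_)
      (solve 2 (λ a i → :- (a :- i) := (:- a) :- (:- i)) refl (lift ⟦ i ⟧) i)
      (ℤ.∣m⇒∣-m (lift-⟦⟧ i))))

    +-comm : ∀ x y → x + y ≡ y + x
    +-comm x y = cong ⟦_⟧ (ℤ.+-comm (lift x) (lift y))

    *-comm : ∀ x y → x * y ≡ y * x
    *-comm x y = cong ⟦_⟧ (ℤ.*-comm (lift x) (lift y))

  -- Every residue is the image of an integer, so it is enough to check an identity on such images,
  -- where the homomorphism laws move it to ℤ.
  elim₁ : {f g : Fin p → Fin p} → (∀ i → f ⟦ i ⟧ ≡ g ⟦ i ⟧) → ∀ x → f x ≡ g x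
  elim₁ {f} {g} h x = subst (λ y → f y ≡ g y) (⟦lift⟧ x) (h (lift x))

  elim₂ : {f g : Fin p → Fin p → Fin p} → (∀ i j → f ⟦ i ⟧ ⟦ j ⟧ ≡ g ⟦ i ⟧ ⟦ j ⟧) → ∀ x y → f x y ≡ g x y
  elim₂ h x = elim₁ λ j → elim₁ (λ i → h i j) x

  elim₃ : {f g : Fin p → Fin p → Fin p → Fin p} → (∀ i j k → f ⟦ i ⟧ ⟦ j ⟧ ⟦ k ⟧ ≡ g ⟦ i ⟧ ⟦ j ⟧ ⟦ k ⟧) → ∀ x y z → f x y z ≡ g x y z
  elim₃ h x y = elim₁ λ k → elim₂ (λ i j → h i j k) x y

  +-assoc : ∀ x y z → (x + y) + z ≡ x + (y + z)
  +-assoc = elim₃ λ i j k → begin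
    (⟦ i ⟧ + ⟦ j ⟧) + ⟦ k ⟧   ≡⟨ cong (_+ ⟦ k ⟧) (+-homo i j) ⟨
    ⟦ i ℤ.+ j ⟧ + ⟦ k ⟧       ≡⟨ +-homo (i ℤ.+ j) k ⟨
    ⟦ i ℤ.+ j ℤ.+ k ⟧         ≡⟨ cong ⟦_⟧ (ℤ.+-assoc i j k) ⟩
    ⟦ i ℤ.+ (j ℤ.+ k) ⟧       ≡⟨ +-homo i (j ℤ.+ k) ⟩
    ⟦ i ⟧ + ⟦ j ℤ.+ k ⟧       ≡⟨ cong (⟦ i ⟧ +_) (+-homo j k) ⟩
    ⟦ i ⟧ + (⟦ j ⟧ + ⟦ k ⟧)   ∎
    where open ≡-Reasoning

  *-assoc : ∀ x y z → (x * y) * z ≡ x * (y * z)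
  *-assoc = elim₃ λ i j k → begin
    (⟦ i ⟧ * ⟦ j ⟧) * ⟦ k ⟧   ≡⟨ cong (_* ⟦ k ⟧) (*-homo i j) ⟨
    ⟦ i ℤ.* j ⟧ * ⟦ k ⟧       ≡⟨ *-homo (i ℤ.* j) k ⟨
    ⟦ i ℤ.* j ℤ.* k ⟧         ≡⟨ cong ⟦_⟧ (ℤ.*-assoc i j k) ⟩
    ⟦ i ℤ.* (j ℤ.* k) ⟧       ≡⟨ *-homo i (j ℤ.* k) ⟩
    ⟦ i ⟧ * ⟦ j ℤ.* k ⟧       ≡⟨ cong (⟦ i ⟧ *_) (*-homo j k) ⟩
    ⟦ i ⟧ * (⟦ j ⟧ * ⟦ k ⟧)   ∎
    where open ≡-Reasoning

  *-distribˡ-+ : ∀ x y z → x * (y + z) ≡ x * y + x * z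
  *-distribˡ-+ = elim₃ λ i j k → begin
    ⟦ i ⟧ * (⟦ j ⟧ + ⟦ k ⟧)           ≡⟨ cong (⟦ i ⟧ *_) (+-homo j k) ⟨
    ⟦ i ⟧ * ⟦ j ℤ.+ k ⟧               ≡⟨ *-homo i (j ℤ.+ k) ⟨
    ⟦ i ℤ.* (j ℤ.+ k) ⟧               ≡⟨ cong ⟦_⟧ (ℤ.*-distribˡ-+ i j k) ⟩
    ⟦ i ℤ.* j ℤ.+ i ℤ.* k ⟧           ≡⟨ +-homo (i ℤ.* j) (i ℤ.* k) ⟩
    ⟦ i ℤ.* j ⟧ + ⟦ i ℤ.* k ⟧         ≡⟨ cong₂ _+_ (*-homo i j) (*-homo i k) ⟩
    ⟦ i ⟧ * ⟦ j ⟧ + ⟦ i ⟧ * ⟦ k ⟧     ∎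
    where open ≡-Reasoning

  *-distribʳ-+ : ∀ x y z → (y + z) * x ≡ y * x + z * x
  *-distribʳ-+ x y z = trans (*-comm (y + z) x) (trans (*-distribˡ-+ x y z) (cong₂ _+_ (*-comm x y) (*-comm x z)))

  +-identityˡ : ∀ x → 0# + x ≡ x
  +-identityˡ = elim₁ λ i → trans (sym (+-homo (pos 0) i)) (cong ⟦_⟧ (ℤ.+-identityˡ i))

  *-identityˡ : ∀ x → 1# * x ≡ x
  *-identityˡ = elim₁ λ i → trans (sym (*-homo (pos 1) i)) (cong ⟦_⟧ (ℤ.*-identityˡ i))

  -‿inverseʳ : ∀ x → x + (- x) ≡ 0#
  -‿inverseʳ = elim₁ λ i → trans (cong (⟦ i ⟧ +_) (sym (-‿homo i))) (trans (sym (+-homo i (ℤ.- i))) (cong ⟦_⟧ (ℤ.+-inverseʳ i)))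

  isCommutativeRing : IsCommutativeRing _≡_ _+_ _*_ -_ 0# 1#
  isCommutativeRing = record
    { isRing = record
      { +-isAbelianGroup = record
        { isGroup = record
          { isMonoid = record
            { isSemigroup = record
              { isMagma = record { isEquivalence = isEquivalence ; ∙-cong = cong₂ _+_ }
              ; assoc = +-assoc }
            ; identity = +-identityˡ , λ x → trans (+-comm x 0#) (+-identityˡ x) }
          ; inverse = (λ x → trans (+-comm (- x) x) (-‿inverseʳ x)) , -‿inverseʳ
          ; ⁻¹-cong = cong (λ x → - x) }
        ; comm = +-comm }
      ; *-cong = cong₂ _*_
      ; *-assoc = *-assoc
      ; *-identity = *-identityˡ , λ x → trans (*-comm x 1#) (*-identityˡ x)
      ; distrib = *-distribˡ-+ , *-distribʳ-+ }
    ; *-comm = *-comm }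

  commutativeRing : CommutativeRing _ _
  commutativeRing = record { isCommutativeRing = isCommutativeRing }

  ⟦⟧-morphism : CommutativeRing.rawRing ℤ.+-*-commutativeRing -Raw-AlmostCommutative⟶ fromCommutativeRing commutativeRing
  ⟦⟧-morphism = record
    { ⟦_⟧ = ⟦_⟧ ; +-homo = +-homo ; *-homo = *-homo ; -‿homo = -‿homo ; 0-homo = refl ; 1-homo = refl }

  ⟦⟧-weaklyDec : ∀ i j → Maybe (⟦ i ⟧ ≡ ⟦ j ⟧)
  ⟦⟧-weaklyDec i j with i ℤ.≟ j
  ... | yes i≡j = just (cong ⟦_⟧ i≡j)
  ... | no _    = nothing

  module Solver = Algebra.Solver.Ring (CommutativeRing.rawRing ℤ.+-*-commutativeRing)
    (fromCommutativeRing commutativeRing) ⟦⟧-morphism ⟦⟧-weaklyDec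


  pos∣⇒⟦⟧≡0 : ∀ {x} → p ℕ.∣ x → ⟦ pos x ⟧ ≡ 0#
  pos∣⇒⟦⟧≡0 {x} d = ⟦⟧-cong (pos x) (pos 0) (subst (pos p ℤ.∣_) (sym (ℤ.+-identityʳ (pos x))) (ℤ.∣ᵤ⇒∣ d))

  ⟦⟧≡0⇒∣ : ∀ {x} → ⟦ pos x ⟧ ≡ 0# → p ℕ.∣ x
  ⟦⟧≡0⇒∣ {x} eq = ℤ.∣⇒∣ᵤ (subst (pos p ℤ.∣_) (ℤ.+-identityʳ (pos x)) (⟦⟧-cong⁻¹ {pos x} {pos 0} eq))

-- The field ℤ/p for a prime p

module PrimeField (p : ℕ) (p-prime : Prime p) where

  instance
    p≢0 : NonZero p
    p≢0 = prime⇒nonZero p-prime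

  open Residues p public
  open CommutativeRing commutativeRing public using (+-identityʳ; *-identityʳ; zeroˡ; zeroʳ)
  open Solver using (solve; _:=_; _:+_; _:*_; _:-_; :-_; con)

  1≢0 : 1# ≢ 0#
  1≢0 eq = contradiction (⟦⟧≡0⇒∣ {1} eq) (ℕ.>⇒∤ (ℕ.nonTrivial⇒n>1 p {{prime⇒nonTrivial p-prime}}))

  toℕ≡0⇒≡0 : ∀ x → toℕ x ≡ 0 → x ≡ 0#
  toℕ≡0⇒≡0 x eq = trans (sym (⟦lift⟧ x)) (cong (λ k → ⟦ pos k ⟧) eq)

  pos-hom : ∀ a b c → 1 ℕ.+ a ℕ.* p ≡ b ℕ.* c → 1# ≡ ⟦ pos b ⟧ * ⟦ pos c ⟧
  pos-hom a b c eq = begin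
    1#                                 ≡⟨ +-identityʳ 1# ⟨
    1# + 0#                            ≡⟨ cong (1# +_) (pos∣⇒⟦⟧≡0 (ℕ.n∣m*n a)) ⟨
    1# + ⟦ pos (a ℕ.* p) ⟧             ≡⟨ +-homo (pos 1) (pos (a ℕ.* p)) ⟨
    ⟦ pos (1 ℕ.+ a ℕ.* p) ⟧            ≡⟨ cong (λ k → ⟦ pos k ⟧) eq ⟩
    ⟦ pos (b ℕ.* c) ⟧                  ≡⟨ cong ⟦_⟧ (ℤ.pos-* b c) ⟩
    ⟦ pos b ℤ.* pos c ⟧                ≡⟨ *-homo (pos b) (pos c) ⟩
    ⟦ pos b ⟧ * ⟦ pos c ⟧              ∎
    where open ≡-Reasoning

  hasInverse : ∀ x → x ≢ 0# → ∃[ y ] y * x ≡ 1#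
  hasInverse x x≢0 with coprime-Bézout (prime⇒coprime p-prime {{ℕ.≢-nonZero (x≢0 ∘ toℕ≡0⇒≡0 x)}} (toℕ<n x))
  ... | Bézout.-+ a b eq = ⟦ pos b ⟧ , sym (trans (pos-hom a b (toℕ x) eq) (cong (⟦ pos b ⟧ *_) (⟦lift⟧ x)))
  -- With this sign the identity reads 1 + b x = a p, so the inverse is -b.
  ... | Bézout.+- a b eq = - ⟦ pos b ⟧ , (begin
    (- B) * x                              ≡⟨ solve 2 (λ b x → (:- b) :* x := con (pos 1) :- (con (pos 1) :+ b :* x)) refl B x ⟩
    1# - (1# + B * x)                      ≡⟨ cong (λ z → 1# - (1# + B * z)) (⟦lift⟧ x) ⟨
    1# - (1# + B * ⟦ pos (toℕ x) ⟧)
      ≡⟨ cong (λ z → 1# - (1# + z)) (trans (cong ⟦_⟧ (ℤ.pos-* b (toℕ x))) (*-homo (pos b) (pos (toℕ x)))) ⟨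
    1# - (1# + ⟦ pos (b ℕ.* toℕ x) ⟧)      ≡⟨ cong (λ z → 1# - z) (+-homo (pos 1) (pos (b ℕ.* toℕ x))) ⟨
    1# - ⟦ pos (1 ℕ.+ b ℕ.* toℕ x) ⟧       ≡⟨ cong (λ z → 1# - z) (pos∣⇒⟦⟧≡0 (ℕ.divides a eq)) ⟩
    1# - 0#                                ≡⟨ solve 0 (con (pos 1) :- con (pos 0) := con (pos 1)) refl ⟩
    1#                                     ∎)
    where
    open ≡-Reasoning
    B = ⟦ pos b ⟧

  -- Totalised by 0⁻¹ = 0, which makes inversion an involution of all of ℤ/p and so a legitimate
  -- substitution in sums.
  _⁻¹ : Fin p → Fin p
  x ⁻¹ with x ≟ 0#
  ... | yes _  = 0#
  ... | no x≢0 = proj₁ (hasInverse x x≢0)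

  ⁻¹-inverseˡ : ∀ {x} → x ≢ 0# → x ⁻¹ * x ≡ 1#
  ⁻¹-inverseˡ {x} x≢0 with x ≟ 0#
  ... | yes x≡0 = contradiction x≡0 x≢0
  ... | no x≢0  = proj₂ (hasInverse x x≢0)

  ⁻¹-inverseʳ : ∀ {x} → x ≢ 0# → x * x ⁻¹ ≡ 1#
  ⁻¹-inverseʳ {x} x≢0 = trans (*-comm x (x ⁻¹)) (⁻¹-inverseˡ x≢0)

  0⁻¹≡0 : 0# ⁻¹ ≡ 0#
  0⁻¹≡0 with 0# ≟ 0#
  ... | yes _  = refl
  ... | no 0≢0 = contradiction refl 0≢0

  x*y≡0⇒x≡0∨y≡0 : ∀ x y → x * y ≡ 0# → x ≡ 0# ⊎ y ≡ 0#
  x*y≡0⇒x≡0∨y≡0 x y xy≡0 with x ≟ 0#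
  ... | yes x≡0 = inj₁ x≡0
  ... | no x≢0  = inj₂ (begin
    y                ≡⟨ *-identityˡ y ⟨
    1# * y           ≡⟨ cong (_* y) (⁻¹-inverseˡ x≢0) ⟨
    x ⁻¹ * x * y     ≡⟨ *-assoc (x ⁻¹) x y ⟩
    x ⁻¹ * (x * y)   ≡⟨ cong (x ⁻¹ *_) xy≡0 ⟩
    x ⁻¹ * 0#        ≡⟨ zeroʳ (x ⁻¹) ⟩
    0#               ∎)
    where open ≡-Reasoning

  *-≢0 : ∀ {x y} → x ≢ 0# → y ≢ 0# → x * y ≢ 0#
  *-≢0 {x} {y} x≢0 y≢0 xy≡0 with x*y≡0⇒x≡0∨y≡0 x y xy≡0
  ... | inj₁ x≡0 = x≢0 x≡0
  ... | inj₂ y≡0 = y≢0 y≡0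

  ⁻¹-≢0 : ∀ {x} → x ≢ 0# → x ⁻¹ ≢ 0#
  ⁻¹-≢0 {x} x≢0 eq = 1≢0 (trans (sym (⁻¹-inverseˡ x≢0)) (trans (cong (_* x) eq) (zeroˡ x)))

  x-y≡0⇒x≡y : ∀ {x y} → x - y ≡ 0# → x ≡ y
  x-y≡0⇒x≡y {x} {y} eq = trans (solve 2 (λ x y → x := (x :- y) :+ y) refl x y) (trans (cong (_+ y) eq) (+-identityˡ y))

  *-cancelˡ : ∀ {x y z} → x ≢ 0# → x * y ≡ x * z → y ≡ z
  *-cancelˡ {x} {y} {z} x≢0 eq = case x*y≡0⇒x≡0∨y≡0 x (y - z) x[y-z]≡0 of λ where
      (inj₁ x≡0)   → contradiction x≡0 x≢0
      (inj₂ y-z≡0) → x-y≡0⇒x≡y y-z≡0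
    where
    x[y-z]≡0 : x * (y - z) ≡ 0#
    x[y-z]≡0 = begin
      x * (y - z)     ≡⟨ solve 3 (λ x y z → x :* (y :- z) := x :* y :- x :* z) refl x y z ⟩
      x * y - x * z   ≡⟨ cong (λ v → v - x * z) eq ⟩
      x * z - x * z   ≡⟨ -‿inverseʳ (x * z) ⟩
      0#              ∎
      where open ≡-Reasoning

  ⁻¹-involutive : ∀ x → x ⁻¹ ⁻¹ ≡ x
  ⁻¹-involutive x = case x ≟ 0# of λ where
    (yes x≡0) → trans (cong (λ y → y ⁻¹ ⁻¹) x≡0) (trans (cong _⁻¹ 0⁻¹≡0) (trans 0⁻¹≡0 (sym x≡0)))
    (no x≢0)   → *-cancelˡ (⁻¹-≢0 x≢0) (trans (⁻¹-inverseʳ (⁻¹-≢0 x≢0)) (sym (⁻¹-inverseˡ x≢0)))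

-- Counting cubes

ι : ∀ {ℓ} {P : Set ℓ} → Dec P → ℕ
ι P? = if does P? then 1 else 0

ι-yes : ∀ {ℓ} {P : Set ℓ} (P? : Dec P) → P → ι P? ≡ 1
ι-yes (yes _) _ = refl
ι-yes (no ¬P) P = contradiction P ¬P

ι-no : ∀ {ℓ} {P : Set ℓ} (P? : Dec P) → ¬ P → ι P? ≡ 0
ι-no (yes P) ¬P = contradiction P ¬P
ι-no (no _)  _  = refl

ι-⇔ : ∀ {ℓ ℓ′} {P : Set ℓ} {Q : Set ℓ′} (P? : Dec P) (Q? : Dec Q) → (P → Q) → (Q → P) → ι P? ≡ ι Q?
ι-⇔ P? (yes Q) _ from = ι-yes P? (from Q)
ι-⇔ P? (no ¬Q) to _   = ι-no P? (¬Q ∘ to)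

ι≢0⇒ : ∀ {ℓ} {P : Set ℓ} (P? : Dec P) → ι P? ≢ 0 → P
ι≢0⇒ (yes P) _ = P
ι≢0⇒ (no _)  n = contradiction refl n

sum-zero : ∀ {n} (f : Fin n → ℕ) → (∀ i → f i ≡ 0) → sum f ≡ 0
sum-zero {ℕ.zero}  f h = refl
sum-zero {ℕ.suc n} f h = cong₂ ℕ._+_ (h zero) (sum-zero (f ∘ suc) (h ∘ suc))

sum-one : ∀ n → sum {n} (λ _ → 1) ≡ n
sum-one ℕ.zero    = refl
sum-one (ℕ.suc n) = cong ℕ.suc (sum-one n)

sum-mono : ∀ {n} (f g : Fin n → ℕ) → (∀ i → f i ≤ g i) → sum f ≤ sum g
sum-mono {ℕ.zero}  f g h = ℕ.≤-refl
sum-mono {ℕ.suc n} f g h = ℕ.+-mono-≤ (h zero) (sum-mono (f ∘ suc) (g ∘ suc) (h ∘ suc))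

-- A single strict inequality would separate the totals. This later replaces an argument on the
-- index of the group of cubes.
sum-mono-≡ : ∀ {n} (f g : Fin n → ℕ) → (∀ i → f i ≤ g i) → sum f ≡ sum g → ∀ i → f i ≡ g i
sum-mono-≡ {ℕ.suc n} f g h eq = λ where
    zero    → f₀≡g₀
    (suc i) → sum-mono-≡ (f ∘ suc) (g ∘ suc) (h ∘ suc)
                (ℕ.+-cancelˡ-≡ (f zero) _ _ (trans eq (cong (ℕ._+ sum (g ∘ suc)) (sym f₀≡g₀)))) i
  where
  tail-≤ = sum-mono (f ∘ suc) (g ∘ suc) (h ∘ suc)
  f₀≡g₀ : f zero ≡ g zero
  f₀≡g₀ = ℕ.≤-antisym (h zero) (ℕ.+-cancelʳ-≤ (sum (f ∘ suc)) (g zero) (f zero)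
    (ℕ.≤-trans (ℕ.+-monoʳ-≤ (g zero) tail-≤) (ℕ.≤-reflexive (sym eq))))

sum-ι≟ : ∀ {n} (a : Fin n) (f : Fin n → ℕ) → sum (λ i → ι (i ≟ a) ℕ.* f i) ≡ f a
sum-ι≟ zero    f = trans (cong₂ ℕ._+_ (ℕ.*-identityˡ (f zero)) (sum-zero (λ i → ι (suc i ≟ zero) ℕ.* f (suc i)) λ _ → refl)) (ℕ.+-identityʳ (f zero))
sum-ι≟ (suc a) f = sum-ι≟ a (f ∘ suc)

sum-ι≟-one : ∀ {n} (a : Fin n) → sum (λ i → ι (i ≟ a)) ≡ 1
sum-ι≟-one a = trans (sum-cong-≗ λ i → sym (ℕ.*-identityʳ (ι (i ≟ a)))) (sum-ι≟ a λ _ → 1)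

-- A missed value could be punched out of the codomain, leaving an injection into a smaller finite
-- set.
injective⇒surjective : ∀ {n} {f : Fin n → Fin n} → (∀ {x y} → f x ≡ f y → x ≡ y) → ∀ y → ∃[ x ] f x ≡ y
injective⇒surjective {ℕ.suc n} {f} inj y with any? (λ x → f x ≟ y)
... | yes hit = hit
... | no miss = contradiction (injective⇒≤ {f = λ x → punchOut (y≢f x)} (λ eq → inj (punchOut-injective (y≢f _) (y≢f _) eq))) ℕ.1+n≰n
  where
  y≢f : ∀ x → y ≢ f x
  y≢f x y≡fx = miss (x , sym y≡fx)

module Cubes (p : ℕ) (p-prime : Prime p) where

  open PrimeField p p-prime public
  open Solver using (solve; _:=_; _:+_; _:*_; _:-_; :-_; con)

  ∑ : (Fin p → ℕ) → ℕ
  ∑ = sum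

  ∑-shift : ∀ c f → ∑ f ≡ ∑ (λ x → f (x - c))
  ∑-shift c f = sum-permute f (permutation (_- c) (_+ c)
    (λ x → solve 2 (λ x c → (x :+ c) :- c := x) refl x c)
    (λ x → solve 2 (λ x c → (x :- c) :+ c := x) refl x c))

  ∑-reflect : ∀ c f → ∑ f ≡ ∑ (λ x → f (c - x))
  ∑-reflect c f = sum-permute f (permutation (λ x → c - x) (λ x → c - x)
    (λ x → solve 2 (λ x c → c :- (c :- x) := x) refl x c)
    (λ x → solve 2 (λ x c → c :- (c :- x) := x) refl x c))

  ⁻¹-cancelˡ : ∀ {u} → u ≢ 0# → ∀ x → u ⁻¹ * (u * x) ≡ x
  ⁻¹-cancelˡ {u} u≢0 x = trans (sym (*-assoc (u ⁻¹) u x)) (trans (cong (_* x) (⁻¹-inverseˡ u≢0)) (*-identityˡ x))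

  ⁻¹-cancelʳ : ∀ {u} → u ≢ 0# → ∀ x → u * (u ⁻¹ * x) ≡ x
  ⁻¹-cancelʳ {u} u≢0 x = trans (sym (*-assoc u (u ⁻¹) x)) (trans (cong (_* x) (⁻¹-inverseʳ u≢0)) (*-identityˡ x))

  ∑-scale : ∀ {u} → u ≢ 0# → ∀ f → ∑ f ≡ ∑ (λ x → f (u * x))
  ∑-scale {u} u≢0 f = sum-permute f (permutation (u *_) (u ⁻¹ *_) (⁻¹-cancelʳ u≢0) (⁻¹-cancelˡ u≢0))

  ∑-⁻¹ : ∀ f → ∑ f ≡ ∑ (λ x → f (x ⁻¹))
  ∑-⁻¹ f = sum-permute f (permutation _⁻¹ _⁻¹ ⁻¹-involutive ⁻¹-involutive)

  cube : Fin p → Fin p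
  cube x = x * x * x

  Cube : Fin p → Set
  Cube x = ∃[ b ] (b ≢ 0# × cube b ≡ x)

  cube? : ∀ x → Dec (Cube x)
  cube? x = any? λ b → ¬? (b ≟ 0#) ×-dec (cube b ≟ x)

  cube-* : ∀ x y → cube (x * y) ≡ cube x * cube y
  cube-* = solve 2 (λ x y → (x :* y) :* (x :* y) :* (x :* y) := (x :* x :* x) :* (y :* y :* y)) refl

  cube-1 : cube 1# ≡ 1#
  cube-1 = solve 0 (con (pos 1) :* con (pos 1) :* con (pos 1) := con (pos 1)) refl

  Cube-cube : ∀ {x} → x ≢ 0# → Cube (cube x)
  Cube-cube {x} x≢0 = x , x≢0 , refl

  Cube⇒≢0 : ∀ {x} → Cube x → x ≢ 0#
  Cube⇒≢0 (b , b≢0 , refl) = *-≢0 (*-≢0 b≢0 b≢0) b≢0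

  Cube-1 : Cube 1#
  Cube-1 = 1# , 1≢0 , cube-1

  Cube-* : ∀ {x y} → Cube x → Cube y → Cube (x * y)
  Cube-* (b , b≢0 , refl) (c , c≢0 , refl) = b * c , *-≢0 b≢0 c≢0 , cube-* b c

  -‿≢0 : ∀ {x} → x ≢ 0# → - x ≢ 0#
  -‿≢0 {x} x≢0 -x≡0 = x≢0 (begin
    x         ≡⟨ solve 1 (λ x → x := :- (:- x)) refl x ⟩
    - (- x)   ≡⟨ cong (λ y → - y) -x≡0 ⟩
    - 0#      ≡⟨ solve 0 (:- con (pos 0) := con (pos 0)) refl ⟩
    0#        ∎)
    where open ≡-Reasoning

  Cube-neg : ∀ {x} → Cube x → Cube (- x)
  Cube-neg (b , b≢0 , refl) = - b , -‿≢0 b≢0 , solve 1 (λ b → (:- b) :* (:- b) :* (:- b) := :- (b :* b :* b)) refl b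

  Cube-⁻¹ : ∀ {x} → Cube x → Cube (x ⁻¹)
  Cube-⁻¹ {x} X@(b , b≢0 , b³≡x) = b ⁻¹ , ⁻¹-≢0 b≢0 , *-cancelˡ (Cube⇒≢0 X) (begin
    x * cube (b ⁻¹)        ≡⟨ cong (_* cube (b ⁻¹)) b³≡x ⟨
    cube b * cube (b ⁻¹)   ≡⟨ cube-* b (b ⁻¹) ⟨
    cube (b * b ⁻¹)        ≡⟨ cong cube (⁻¹-inverseʳ b≢0) ⟩
    cube 1#                ≡⟨ cube-1 ⟩
    1#                     ≡⟨ ⁻¹-inverseʳ (Cube⇒≢0 X) ⟨
    x * x ⁻¹               ∎)
    where open ≡-Reasoning

  Cube-cancelˡ : ∀ {c x} → Cube c → Cube (c * x) → Cube x
  Cube-cancelˡ {c} {x} C CX = subst Cube (⁻¹-cancelˡ (Cube⇒≢0 C) x) (Cube-* (Cube-⁻¹ C) CX)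

  Cube-cancelʳ : ∀ {c x} → Cube c → Cube (x * c) → Cube x
  Cube-cancelʳ {c} {x} C XC = Cube-cancelˡ C (subst Cube (*-comm x c) XC)

  χ : Fin p → ℕ
  χ x = ι (cube? x)

  χ-* : ∀ {c} → Cube c → ∀ x → χ (c * x) ≡ χ x
  χ-* C x = ι-⇔ (cube? _) (cube? x) (Cube-cancelˡ C) (Cube-* C)

  χ-neg : ∀ x → χ (- x) ≡ χ x
  χ-neg x = ι-⇔ (cube? (- x)) (cube? x)
    (λ C → subst Cube (solve 1 (λ x → :- (:- x) := x) refl x) (Cube-neg C)) Cube-neg

  χ-0 : χ 0# ≡ 0
  χ-0 = ι-no (cube? 0#) (λ C → Cube⇒≢0 C refl)

  cube≡0⇒≡0 : ∀ {x} → cube x ≡ 0# → x ≡ 0#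
  cube≡0⇒≡0 {x} eq = case x ≟ 0# of λ where
    (yes x≡0) → x≡0
    (no x≢0)  → contradiction eq (*-≢0 (*-≢0 x≢0 x≢0) x≢0)

  module Cosets (g : Fin p) (g≢0 : g ≢ 0#) (¬Cube-g : ¬ Cube g) where

    f : ℕ
    f = ∑ χ

    -- If 1 were the only cube root of 1, cubing would be injective, hence surjective, and g would
    -- be a cube.
    ∃-root-of-unity : ∃[ w ] (w ≢ 1# × cube w ≡ 1#)
    ∃-root-of-unity = case any? (λ w → ¬? (w ≟ 1#) ×-dec (cube w ≟ 1#)) of λ where
        (yes w)   → w
        (no none) → contradiction (surjective none) ¬Cube-g
      where
      open ≡-Reasoning
      injective : ¬ (∃[ w ] (w ≢ 1# × cube w ≡ 1#)) → ∀ {x y} → cube x ≡ cube y → x ≡ y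
      injective none {x} {y} eq = case y ≟ 0# of λ where
          (yes y≡0) → trans (cube≡0⇒≡0 (trans eq (trans (cong cube y≡0) (trans (cong (_* 0#) (zeroˡ 0#)) (zeroˡ 0#))))) (sym y≡0)
          (no y≢0) → case y ⁻¹ * x ≟ 1# of λ where
            (yes eq₁) → begin
              x                ≡⟨ ⁻¹-cancelʳ y≢0 x ⟨
              y * (y ⁻¹ * x)   ≡⟨ cong (y *_) eq₁ ⟩
              y * 1#           ≡⟨ *-identityʳ y ⟩
              y                ∎
            (no neq) → contradiction (y ⁻¹ * x , neq , (begin
              cube (y ⁻¹ * x)          ≡⟨ cube-* (y ⁻¹) x ⟩
              cube (y ⁻¹) * cube x     ≡⟨ cong (cube (y ⁻¹) *_) eq ⟩
              cube (y ⁻¹) * cube y     ≡⟨ cube-* (y ⁻¹) y ⟨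
              cube (y ⁻¹ * y)          ≡⟨ cong cube (⁻¹-inverseˡ y≢0) ⟩
              cube 1#                  ≡⟨ cube-1 ⟩
              1#                       ∎)) none
      surjective : ¬ (∃[ w ] (w ≢ 1# × cube w ≡ 1#)) → Cube g
      surjective none = case injective⇒surjective {f = cube} (injective none) g of λ where
        (b , eq) → b , (λ b≡0 → g≢0 (trans (sym eq) (trans (cong cube b≡0) (trans (cong (_* 0#) (zeroˡ 0#)) (zeroˡ 0#))))) , eq

    w : Fin p
    w = proj₁ ∃-root-of-unity

    w≢1 : w ≢ 1#
    w≢1 = proj₁ (proj₂ ∃-root-of-unity)

    w³≡1 : cube w ≡ 1#
    w³≡1 = proj₂ (proj₂ ∃-root-of-unity)

    w≢0 : w ≢ 0#
    w≢0 w≡0 = 1≢0 (trans (sym w³≡1) (trans (cong (w * w *_) w≡0) (zeroʳ (w * w))))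

    w²≢1 : w * w ≢ 1#
    w²≢1 eq = w≢1 (trans (sym (*-identityˡ w)) (trans (cong (_* w) (sym eq)) w³≡1))

    1+w+w²≡0 : 1# + w + w * w ≡ 0#
    1+w+w²≡0 = case x*y≡0⇒x≡0∨y≡0 (w - 1#) (1# + w + w * w) product≡ of λ where
        (inj₁ w-1≡0) → contradiction (x-y≡0⇒x≡y w-1≡0) w≢1
        (inj₂ eq)    → eq
      where
      product≡ : (w - 1#) * (1# + w + w * w) ≡ 0#
      product≡ = trans
        (solve 1 (λ w → (w :- con (pos 1)) :* (con (pos 1) :+ w :+ w :* w) := w :* w :* w :- con (pos 1)) refl w)
        (trans (cong (λ v → v - 1#) w³≡1) (-‿inverseʳ 1#))

    -- Since w³ = 1, the product (x - b)(x - w b)(x - w² b) differs from x³ - b³ by a multiple of 1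
    -- + w + w², which is 0.
    roots : ∀ b x → cube x ≡ cube b → x ≡ b ⊎ x ≡ w * b ⊎ x ≡ w * w * b
    roots b x eq = case x*y≡0⇒x≡0∨y≡0 ((x - b) * (x - w * b)) (x - w * w * b) product≡ of λ where
        (inj₂ e) → inj₂ (inj₂ (x-y≡0⇒x≡y e))
        (inj₁ e) → case x*y≡0⇒x≡0∨y≡0 (x - b) (x - w * b) e of λ where
          (inj₁ e₁) → inj₁ (x-y≡0⇒x≡y e₁)
          (inj₂ e₂) → inj₂ (inj₁ (x-y≡0⇒x≡y e₂))
      where
      open ≡-Reasoning
      product≡ : (x - b) * (x - w * b) * (x - w * w * b) ≡ 0#
      product≡ = begin
        (x - b) * (x - w * b) * (x - w * w * b)
          ≡⟨ solve 3 (λ x b w → (x :- b) :* (x :- w :* b) :* (x :- w :* w :* b)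
               := x :* x :* x :- (w :* w :* w) :* (b :* b :* b) :- (con (pos 1) :+ w :+ w :* w) :* (b :* x :* (x :- w :* b))) refl x b w ⟩
        cube x - cube w * cube b - (1# + w + w * w) * (b * x * (x - w * b))
          ≡⟨ cong₂ (λ u v → u - v * cube b - (1# + w + w * w) * (b * x * (x - w * b))) eq w³≡1 ⟩
        cube b - 1# * cube b - (1# + w + w * w) * (b * x * (x - w * b))
          ≡⟨ cong (λ u → cube b - 1# * cube b - u * (b * x * (x - w * b))) 1+w+w²≡0 ⟩
        cube b - 1# * cube b - 0# * (b * x * (x - w * b))
          ≡⟨ solve 2 (λ c y → c :- con (pos 1) :* c :- con (pos 0) :* y := con (pos 0)) refl (cube b) (b * x * (x - w * b)) ⟩
        0# ∎

    cube-root-of-unity-* : ∀ {u} b → cube u ≡ 1# → cube (u * b) ≡ cube b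
    cube-root-of-unity-* {u} b eq = trans (cube-* u b) (trans (cong (_* cube b) eq) (*-identityˡ (cube b)))

    cube-w² : cube (w * w) ≡ 1#
    cube-w² = trans (cube-* w w) (trans (cong₂ _*_ w³≡1 w³≡1) (*-identityˡ 1#))

    -- `roots` leaves only these three candidates; they are distinct because neither w nor w² is 1.
    fibre : ∀ {b} → b ≢ 0# → ∀ x → ι (cube x ≟ cube b) ≡ ι (x ≟ b) ℕ.+ ι (x ≟ w * b) ℕ.+ ι (x ≟ w * w * b)
    fibre {b} b≢0 x = case x ≟ b of λ where
        (yes x≡b) → split 1 1 0 0 (ι-yes (_ ≟ _) (cong cube x≡b)) (ι-yes (x ≟ b) x≡b)
          (ι-no (_ ≟ _) λ e → b≢wb (trans (sym x≡b) e)) (ι-no (_ ≟ _) λ e → b≢w²b (trans (sym x≡b) e)) refl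
        (no x≢b) → case x ≟ w * b of λ where
          (yes x≡wb) → split 1 0 1 0 (ι-yes (_ ≟ _) (trans (cong cube x≡wb) (cube-root-of-unity-* b w³≡1))) (ι-no (x ≟ b) x≢b)
            (ι-yes (_ ≟ _) x≡wb) (ι-no (_ ≟ _) λ e → wb≢w²b (trans (sym x≡wb) e)) refl
          (no x≢wb) → case x ≟ w * w * b of λ where
            (yes x≡w²b) → split 1 0 0 1 (ι-yes (_ ≟ _) (trans (cong cube x≡w²b) (cube-root-of-unity-* b cube-w²))) (ι-no (x ≟ b) x≢b)
              (ι-no (_ ≟ _) x≢wb) (ι-yes (_ ≟ _) x≡w²b) refl
            (no x≢w²b) → split 0 0 0 0
              (ι-no (_ ≟ _) λ e → case roots b x e of λ where
                (inj₁ e₁)        → x≢b e₁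
                (inj₂ (inj₁ e₁)) → x≢wb e₁
                (inj₂ (inj₂ e₁)) → x≢w²b e₁)
              (ι-no (x ≟ b) x≢b) (ι-no (_ ≟ _) x≢wb) (ι-no (_ ≟ _) x≢w²b) refl
      where
      split : ∀ {i j k l} i′ j′ k′ l′ → i ≡ i′ → j ≡ j′ → k ≡ k′ → l ≡ l′ → i′ ≡ j′ ℕ.+ k′ ℕ.+ l′ → i ≡ j ℕ.+ k ℕ.+ l
      split _ _ _ _ refl refl refl refl eq = eq
      u*b≢b : ∀ {u} → u ≢ 1# → b ≢ u * b
      u*b≢b {u} u≢1 eq = u≢1 (*-cancelˡ b≢0 (trans (*-comm b u) (trans (sym eq) (sym (*-identityʳ b)))))
      b≢wb : b ≢ w * b
      b≢wb = u*b≢b w≢1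
      b≢w²b : b ≢ w * w * b
      b≢w²b = u*b≢b w²≢1
      wb≢w²b : w * b ≢ w * w * b
      wb≢w²b eq = b≢wb (*-cancelˡ w≢0 (trans eq (*-assoc w w b)))

    fibre-size : ∀ t → ∑ (λ x → ι (t ≟ cube x)) ≡ 3 ℕ.* χ t ℕ.+ ι (t ≟ 0#)
    fibre-size t = case cube? t of λ where
        (yes C@(b , b≢0 , b³≡t)) → begin
          ∑ (λ x → ι (t ≟ cube x))
            ≡⟨ sum-cong-≗ (λ x → trans (ι-⇔ (t ≟ cube x) (cube x ≟ cube b) (λ e → trans (sym e) (sym b³≡t)) (λ e → trans (sym b³≡t) (sym e))) (fibre b≢0 x)) ⟩
          ∑ (λ x → ι (x ≟ b) ℕ.+ ι (x ≟ w * b) ℕ.+ ι (x ≟ w * w * b))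
            ≡⟨ ∑-distrib-+ (λ x → ι (x ≟ b) ℕ.+ ι (x ≟ w * b)) (λ x → ι (x ≟ w * w * b)) ⟩
          ∑ (λ x → ι (x ≟ b) ℕ.+ ι (x ≟ w * b)) ℕ.+ ∑ (λ x → ι (x ≟ w * w * b))
            ≡⟨ cong₂ ℕ._+_ (trans (∑-distrib-+ (λ x → ι (x ≟ b)) (λ x → ι (x ≟ w * b))) (cong₂ ℕ._+_ (sum-ι≟-one b) (sum-ι≟-one (w * b)))) (sum-ι≟-one (w * w * b)) ⟩
          3
            ≡⟨ cong₂ (λ i j → 3 ℕ.* i ℕ.+ j) (ι-yes (cube? t) C) (ι-no (t ≟ 0#) (Cube⇒≢0 C)) ⟨
          3 ℕ.* χ t ℕ.+ ι (t ≟ 0#) ∎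
        (no ¬C) → case t ≟ 0# of λ where
          (yes t≡0) → begin
            ∑ (λ x → ι (t ≟ cube x))
              ≡⟨ sum-cong-≗ (λ x → ι-⇔ (t ≟ cube x) (x ≟ 0#) (λ e → cube≡0⇒≡0 (trans (sym e) t≡0))
                   (λ e → trans t≡0 (sym (trans (cong (x * x *_) e) (zeroʳ (x * x)))))) ⟩
            ∑ (λ x → ι (x ≟ 0#))
              ≡⟨ sum-ι≟-one 0# ⟩
            1
              ≡⟨ cong₂ (λ i j → 3 ℕ.* i ℕ.+ j) (ι-no (cube? t) ¬C) (ι-yes (t ≟ 0#) t≡0) ⟨
            3 ℕ.* χ t ℕ.+ ι (t ≟ 0#) ∎
          (no t≢0) → begin
            ∑ (λ x → ι (t ≟ cube x))
              ≡⟨ sum-zero _ (λ x → ι-no (t ≟ cube x) (λ e → ¬C (x , (λ x≡0 → t≢0 (trans e (trans (cong (x * x *_) x≡0) (zeroʳ (x * x))))) , sym e))) ⟩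
            0
              ≡⟨ cong₂ (λ i j → 3 ℕ.* i ℕ.+ j) (ι-no (cube? t) ¬C) (ι-no (t ≟ 0#) t≢0) ⟨
            3 ℕ.* χ t ℕ.+ ι (t ≟ 0#) ∎
      where open ≡-Reasoning

    -- Double counting of the pairs (t, x) with t = x³: by x there are p of them, by t there are
    -- three over each nonzero cube and one over 0.
    3f+1≡p : 3 ℕ.* f ℕ.+ 1 ≡ p
    3f+1≡p = begin
      3 ℕ.* f ℕ.+ 1                                  ≡⟨ cong₂ ℕ._+_ (*-distribˡ-sum 3 χ) (sym (sum-ι≟-one 0#)) ⟩
      ∑ (λ t → 3 ℕ.* χ t) ℕ.+ ∑ (λ t → ι (t ≟ 0#))   ≡⟨ ∑-distrib-+ (λ t → 3 ℕ.* χ t) (λ t → ι (t ≟ 0#)) ⟨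
      ∑ (λ t → 3 ℕ.* χ t ℕ.+ ι (t ≟ 0#))             ≡⟨ sum-cong-≗ fibre-size ⟨
      ∑ (λ t → ∑ (λ x → ι (t ≟ cube x)))             ≡⟨ ∑-comm (λ t x → ι (t ≟ cube x)) ⟩
      ∑ (λ x → ∑ (λ t → ι (t ≟ cube x)))             ≡⟨ sum-cong-≗ (λ x → sum-ι≟-one (cube x)) ⟩
      ∑ (λ _ → 1)                                    ≡⟨ sum-one p ⟩
      p                                              ∎
      where open ≡-Reasoning

    Cube-g²⇒Cube-g : Cube (g * g) → Cube g
    Cube-g²⇒Cube-g C = Cube-cancelˡ C (Cube-cube g≢0)

    -- How many of the classes T, g²T, gT and {0} contain x. The order is deliberate: `χ (g * x)`
    -- tests x ∈ g⁻¹T = g²T, and `χ (g * g * x)` tests x ∈ gT.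
    coset-count : Fin p → ℕ
    coset-count x = χ x ℕ.+ χ (g * x) ℕ.+ χ (g * g * x) ℕ.+ ι (x ≟ 0#)

    coset-count-≤1 : ∀ x → coset-count x ≤ 1
    coset-count-≤1 x = case cube? x of λ where
        (yes C) → split 1 0 0 0 (ι-yes (cube? x) C) (ι-no (cube? _) λ D → ¬Cube-g (Cube-cancelʳ C D))
          (ι-no (cube? _) λ D → ¬Cube-g (Cube-g²⇒Cube-g (Cube-cancelʳ C D))) (ι-no (x ≟ 0#) (Cube⇒≢0 C)) ℕ.≤-refl
        (no ¬C) → case cube? (g * x) of λ where
          (yes C) → split 0 1 0 0 (ι-no (cube? x) ¬C) (ι-yes (cube? _) C)
            (ι-no (cube? _) λ D → ¬Cube-g (Cube-cancelʳ C (subst Cube (*-assoc g g x) D)))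
            (ι-no (x ≟ 0#) λ e → Cube⇒≢0 C (trans (cong (g *_) e) (zeroʳ g))) ℕ.≤-refl
          (no ¬D) → case cube? (g * g * x) of λ where
            (yes C) → split 0 0 1 0 (ι-no (cube? x) ¬C) (ι-no (cube? _) ¬D) (ι-yes (cube? _) C)
              (ι-no (x ≟ 0#) λ e → Cube⇒≢0 C (trans (cong (g * g *_) e) (zeroʳ (g * g)))) ℕ.≤-refl
            (no ¬E) → split 0 0 0 (ι (x ≟ 0#)) (ι-no (cube? x) ¬C) (ι-no (cube? _) ¬D) (ι-no (cube? _) ¬E) refl (ι≤1 (x ≟ 0#))
      where
      ι≤1 : ∀ {ℓ} {P : Set ℓ} (P? : Dec P) → ι P? ≤ 1
      ι≤1 (yes _) = ℕ.≤-refl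
      ι≤1 (no _)  = ℕ.z≤n
      split : ∀ {i j k l} i′ j′ k′ l′ → i ≡ i′ → j ≡ j′ → k ≡ k′ → l ≡ l′ → i′ ℕ.+ j′ ℕ.+ k′ ℕ.+ l′ ≤ 1 → i ℕ.+ j ℕ.+ k ℕ.+ l ≤ 1
      split _ _ _ _ refl refl refl refl h = h

    -- The classes are disjoint, so no count exceeds 1; the counts add up to 3 f + 1 = p over p
    -- elements, so none is 0. Thus the three cosets exhaust the units.
    coset-count≡1 : ∀ x → coset-count x ≡ 1
    coset-count≡1 = sum-mono-≡ coset-count (λ _ → 1) coset-count-≤1 (begin
      ∑ coset-count
        ≡⟨ ∑-distrib-+ (λ x → χ x ℕ.+ χ (g * x) ℕ.+ χ (g * g * x)) (λ x → ι (x ≟ 0#)) ⟩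
      ∑ (λ x → χ x ℕ.+ χ (g * x) ℕ.+ χ (g * g * x)) ℕ.+ ∑ (λ x → ι (x ≟ 0#))
        ≡⟨ cong₂ ℕ._+_ (∑-distrib-+ (λ x → χ x ℕ.+ χ (g * x)) (λ x → χ (g * g * x))) (sum-ι≟-one 0#) ⟩
      ∑ (λ x → χ x ℕ.+ χ (g * x)) ℕ.+ ∑ (λ x → χ (g * g * x)) ℕ.+ 1
        ≡⟨ cong (λ s → s ℕ.+ ∑ (λ x → χ (g * g * x)) ℕ.+ 1) (∑-distrib-+ χ (λ x → χ (g * x))) ⟩
      f ℕ.+ ∑ (λ x → χ (g * x)) ℕ.+ ∑ (λ x → χ (g * g * x)) ℕ.+ 1
        ≡⟨ cong₂ (λ s t → f ℕ.+ s ℕ.+ t ℕ.+ 1) (∑-scale g≢0 χ) (∑-scale (*-≢0 g≢0 g≢0) χ) ⟨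
      f ℕ.+ f ℕ.+ f ℕ.+ 1
        ≡⟨ cong (ℕ._+ 1) (trans (ℕ.+-assoc f f f) (cong (λ s → f ℕ.+ (f ℕ.+ s)) (sym (ℕ.+-identityʳ f)))) ⟩
      3 ℕ.* f ℕ.+ 1
        ≡⟨ 3f+1≡p ⟩
      p
        ≡⟨ sum-one p ⟨
      ∑ (λ _ → 1) ∎)
      where open ≡-Reasoning

-- Cyclotomic numbers of order three

sum-*-sum : ∀ {m n} (f : Fin m → ℕ) (g : Fin n → ℕ) → sum f ℕ.* sum g ≡ sum (λ x → sum (λ y → f x ℕ.* g y))
sum-*-sum f g = trans (*-distribʳ-sum (sum g) f) (sum-cong-≗ λ x → *-distribˡ-sum (f x) g)

sum≢0⇒∃ : ∀ {n} (f : Fin n → ℕ) → sum f ≢ 0 → ∃[ i ] f i ≢ 0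
sum≢0⇒∃ f ∑f≢0 = case any? (λ i → ¬? (f i ℕ.≟ 0)) of λ where
    (yes i)   → i
    (no none) → contradiction (sum-zero f (all-zero none)) ∑f≢0
  where
  all-zero : ¬ (∃[ i ] f i ≢ 0) → ∀ i → f i ≡ 0
  all-zero none i = case f i ℕ.≟ 0 of λ where
    (yes fi≡0) → fi≡0
    (no fi≢0)  → contradiction (i , fi≢0) none

-- Arithmetic of the four cyclotomic numbers

module _ where

  open ℕSolver using (solve; _:=_; _:+_; _:*_; con)

  2mn≤m²+n² : ∀ m n → 2 ℕ.* (m ℕ.* n) ≤ m ℕ.* m ℕ.+ n ℕ.* n
  2mn≤m²+n² m n = case ℕ.≤-total m n of λ where
      (inj₁ m≤n) → wlog m n m≤n
      (inj₂ n≤m) → subst₂ _≤_ (cong (2 ℕ.*_) (ℕ.*-comm n m)) (ℕ.+-comm (n ℕ.* n) (m ℕ.* m)) (wlog n m n≤m)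
    where
    wlog : ∀ m n → m ≤ n → 2 ℕ.* (m ℕ.* n) ≤ m ℕ.* m ℕ.+ n ℕ.* n
    wlog m n m≤n with k , refl ← ℕ.m≤n⇒∃[o]m+o≡n m≤n = ℕ.≤-trans (ℕ.m≤m+n _ (k ℕ.* k)) (ℕ.≤-reflexive
      (solve 2 (λ m k → con 2 :* (m :* (m :+ k)) :+ k :* k := m :* m :+ (m :+ k) :* (m :+ k)) refl m k))

  -- (m + n)² ≤ 4 (m² + n² − m n), as the difference is 3 (m − n)².
  m²+n²≤m+n+mn⇒m+n≤4 : ∀ m n → m ℕ.* m ℕ.+ n ℕ.* n ≤ m ℕ.+ n ℕ.+ m ℕ.* n → m ℕ.+ n ≤ 4
  m²+n²≤m+n+mn⇒m+n≤4 m n h = cancel (m ℕ.+ n) (ℕ.+-cancelʳ-≤ (4 ℕ.* (m ℕ.* n)) _ _ (begin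
      (m ℕ.+ n) ℕ.* (m ℕ.+ n) ℕ.+ 4 ℕ.* (m ℕ.* n)
        ≡⟨ solve 2 (λ m n → (m :+ n) :* (m :+ n) :+ con 4 :* (m :* n) := m :* m :+ n :* n :+ con 3 :* (con 2 :* (m :* n))) refl m n ⟩
      m ℕ.* m ℕ.+ n ℕ.* n ℕ.+ 3 ℕ.* (2 ℕ.* (m ℕ.* n))
        ≤⟨ ℕ.+-monoʳ-≤ (m ℕ.* m ℕ.+ n ℕ.* n) (ℕ.*-monoʳ-≤ 3 (2mn≤m²+n² m n)) ⟩
      4 ℕ.* (m ℕ.* m ℕ.+ n ℕ.* n)
        ≤⟨ ℕ.*-monoʳ-≤ 4 h ⟩
      4 ℕ.* (m ℕ.+ n ℕ.+ m ℕ.* n)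
        ≡⟨ ℕ.*-distribˡ-+ 4 (m ℕ.+ n) (m ℕ.* n) ⟩
      4 ℕ.* (m ℕ.+ n) ℕ.+ 4 ℕ.* (m ℕ.* n) ∎))
    where
    open ℕ.≤-Reasoning
    cancel : ∀ k → k ℕ.* k ≤ 4 ℕ.* k → k ≤ 4
    cancel ℕ.zero    _ = z≤n
    cancel (ℕ.suc k) h = ℕ.*-cancelʳ-≤ (ℕ.suc k) 4 (ℕ.suc k) h

  module CyclotomicNumbers (a b c d f : ℕ)
    (row₀ : a ℕ.+ b ℕ.+ c ℕ.+ 1 ≡ f) (row₁ : b ℕ.+ c ℕ.+ d ≡ f)
    (quadratic : b ℕ.* b ℕ.+ d ℕ.* d ℕ.+ c ℕ.* c ≡ f ℕ.+ (a ℕ.* c ℕ.+ c ℕ.* b ℕ.+ b ℕ.* a))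
    (6≤f : 6 ≤ f) where

    private
      d≡1+a : d ≡ a ℕ.+ 1
      d≡1+a = ℕ.+-cancelˡ-≡ (b ℕ.+ c) _ _ (trans row₁ (trans (sym row₀)
        (solve 3 (λ a b c → a :+ b :+ c :+ con 1 := b :+ c :+ (a :+ con 1)) refl a b c)))

      -- Meant for the two of a, b, c that remain when the third is 0: m + n ≤ 4 would give f ≤ 5.
      impossible : ∀ m n → m ℕ.+ n ℕ.+ 1 ≡ f → m ℕ.* m ℕ.+ n ℕ.* n ≤ m ℕ.+ n ℕ.+ m ℕ.* n → ⊥
      impossible m n eq h = ℕ.<⇒≱ (ℕ.≤-trans (ℕ.≤-reflexive (cong ℕ.suc (sym eq))) (s≤s (ℕ.+-monoˡ-≤ 1 (m²+n²≤m+n+mn⇒m+n≤4 m n h)))) 6≤f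

    -- Here d = 1, and `quadratic` becomes the equality b² + c² = b + c + b c.
    a≢0 : a ≢ 0
    a≢0 refl = impossible b c row₀ (ℕ.≤-reflexive (ℕ.+-cancelʳ-≡ 1 _ _ (begin
      b ℕ.* b ℕ.+ c ℕ.* c ℕ.+ 1
        ≡⟨ solve 2 (λ b c → b :* b :+ c :* c :+ con 1 := b :* b :+ con 1 :+ c :* c) refl b c ⟩
      b ℕ.* b ℕ.+ 1 ℕ.* 1 ℕ.+ c ℕ.* c                      ≡⟨ cong (λ d → b ℕ.* b ℕ.+ d ℕ.* d ℕ.+ c ℕ.* c) d≡1+a ⟨
      b ℕ.* b ℕ.+ d ℕ.* d ℕ.+ c ℕ.* c                      ≡⟨ quadratic ⟩
      f ℕ.+ (0 ℕ.* c ℕ.+ c ℕ.* b ℕ.+ b ℕ.* 0)              ≡⟨ cong (ℕ._+ (0 ℕ.* c ℕ.+ c ℕ.* b ℕ.+ b ℕ.* 0)) row₀ ⟨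
      b ℕ.+ c ℕ.+ 1 ℕ.+ (0 ℕ.* c ℕ.+ c ℕ.* b ℕ.+ b ℕ.* 0)
        ≡⟨ solve 2 (λ b c → b :+ c :+ con 1 :+ (con 0 :* c :+ c :* b :+ b :* con 0) := b :+ c :+ b :* c :+ con 1) refl b c ⟩
      b ℕ.+ c ℕ.+ b ℕ.* c ℕ.+ 1                            ∎)))
      where open ≡-Reasoning

    d≢0 : d ≢ 0
    d≢0 refl = case trans d≡1+a (ℕ.+-comm a 1) of λ ()

    -- Now d² = (a + 1)² leaves 2 a to spare, so `quadratic` yields a² + c² ≤ a + c + a c. The proof
    -- of `c≢0` is the same with b and c exchanged.
    b≢0 : b ≢ 0
    b≢0 refl = impossible a c (trans (cong (λ s → s ℕ.+ c ℕ.+ 1) (sym (ℕ.+-identityʳ a))) row₀)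
        (ℕ.≤-trans (ℕ.m≤m+n _ (2 ℕ.* a)) (ℕ.≤-reflexive (ℕ.+-cancelʳ-≡ 1 _ _ (begin
      a ℕ.* a ℕ.+ c ℕ.* c ℕ.+ 2 ℕ.* a ℕ.+ 1
        ≡⟨ solve 2 (λ a c → a :* a :+ c :* c :+ con 2 :* a :+ con 1 := (a :+ con 1) :* (a :+ con 1) :+ c :* c) refl a c ⟩
      (a ℕ.+ 1) ℕ.* (a ℕ.+ 1) ℕ.+ c ℕ.* c                        ≡⟨ cong (λ d → d ℕ.* d ℕ.+ c ℕ.* c) d≡1+a ⟨
      d ℕ.* d ℕ.+ c ℕ.* c                                        ≡⟨ quadratic ⟩
      f ℕ.+ (a ℕ.* c ℕ.+ c ℕ.* 0 ℕ.+ 0 ℕ.* a)                    ≡⟨ cong (ℕ._+ (a ℕ.* c ℕ.+ c ℕ.* 0 ℕ.+ 0 ℕ.* a)) row₀ ⟨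
      a ℕ.+ 0 ℕ.+ c ℕ.+ 1 ℕ.+ (a ℕ.* c ℕ.+ c ℕ.* 0 ℕ.+ 0 ℕ.* a)
        ≡⟨ solve 2 (λ a c → a :+ con 0 :+ c :+ con 1 :+ (a :* c :+ c :* con 0 :+ con 0 :* a) := a :+ c :+ a :* c :+ con 1) refl a c ⟩
      a ℕ.+ c ℕ.+ a ℕ.* c ℕ.+ 1                                  ∎))))
      where open ≡-Reasoning

    c≢0 : c ≢ 0
    c≢0 refl = impossible a b (trans (cong (ℕ._+ 1) (sym (ℕ.+-identityʳ (a ℕ.+ b)))) row₀)
        (ℕ.≤-trans (ℕ.m≤m+n _ (2 ℕ.* a)) (ℕ.≤-reflexive (ℕ.+-cancelʳ-≡ 1 _ _ (begin
      a ℕ.* a ℕ.+ b ℕ.* b ℕ.+ 2 ℕ.* a ℕ.+ 1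
        ≡⟨ solve 2 (λ a b → a :* a :+ b :* b :+ con 2 :* a :+ con 1 := b :* b :+ (a :+ con 1) :* (a :+ con 1) :+ con 0) refl a b ⟩
      b ℕ.* b ℕ.+ (a ℕ.+ 1) ℕ.* (a ℕ.+ 1) ℕ.+ 0                  ≡⟨ cong (λ d → b ℕ.* b ℕ.+ d ℕ.* d ℕ.+ 0) d≡1+a ⟨
      b ℕ.* b ℕ.+ d ℕ.* d ℕ.+ 0                                  ≡⟨ quadratic ⟩
      f ℕ.+ (a ℕ.* 0 ℕ.+ 0 ℕ.* b ℕ.+ b ℕ.* a)                    ≡⟨ cong (ℕ._+ (a ℕ.* 0 ℕ.+ 0 ℕ.* b ℕ.+ b ℕ.* a)) row₀ ⟨
      a ℕ.+ b ℕ.+ 0 ℕ.+ 1 ℕ.+ (a ℕ.* 0 ℕ.+ 0 ℕ.* b ℕ.+ b ℕ.* a)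
        ≡⟨ solve 2 (λ a b → a :+ b :+ con 0 :+ con 1 :+ (a :* con 0 :+ con 0 :* b :+ b :* a) := a :+ b :+ a :* b :+ con 1) refl a b ⟩
      a ℕ.+ b ℕ.+ a ℕ.* b ℕ.+ 1                                  ∎))))
      where open ≡-Reasoning

-- Representation counts, their symmetries and the ternary equation

module Cyclotomy (p : ℕ) (p-prime : Prime p) where

  open Cubes p p-prime public
  open Solver using (solve; _:=_; _:+_; _:*_; _:-_; :-_; con)

  conv : (Fin p → ℕ) → (Fin p → ℕ) → Fin p → ℕ
  conv φ ψ t = ∑ λ x → φ x ℕ.* ψ (t - x)

  -- Both sides count the quadruples with x + y = v + u, weighted by φ x φ v ψ y ψ u; on the right the equation is
  -- read as x − v = u − y.
  ∑-conv² : ∀ {φ ψ} → (∀ x → φ (- x) ≡ φ x) → (∀ x → ψ (- x) ≡ ψ x) →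
            ∑ (λ t → conv φ ψ t ℕ.* conv φ ψ t) ≡ ∑ (λ t → conv φ φ t ℕ.* conv ψ ψ t)
  ∑-conv² {φ} {ψ} φ-even ψ-even = begin
    ∑ (λ t → conv φ ψ t ℕ.* conv φ ψ t)
      ≡⟨ sum-cong-≗ (λ t → sum-*-sum (λ x → φ x ℕ.* ψ (t - x)) (λ y → φ y ℕ.* ψ (t - y))) ⟩
    ∑ (λ t → ∑ λ x → ∑ λ v → φ x ℕ.* ψ (t - x) ℕ.* (φ v ℕ.* ψ (t - v)))
      ≡⟨ ∑-comm (λ t x → ∑ λ v → φ x ℕ.* ψ (t - x) ℕ.* (φ v ℕ.* ψ (t - v))) ⟩
    ∑ (λ x → ∑ λ t → ∑ λ v → φ x ℕ.* ψ (t - x) ℕ.* (φ v ℕ.* ψ (t - v)))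
      ≡⟨ sum-cong-≗ (λ x → ∑-comm (λ t v → φ x ℕ.* ψ (t - x) ℕ.* (φ v ℕ.* ψ (t - v)))) ⟩
    ∑ (λ x → ∑ λ v → ∑ λ s → φ x ℕ.* ψ (s - x) ℕ.* (φ v ℕ.* ψ (s - v)))
      ≡⟨ sum-cong-≗ (λ x → sum-cong-≗ λ v → sum-cong-≗ λ s → pointwise x v s) ⟩
    ∑ (λ x → ∑ λ v → ∑ λ s → φ x ℕ.* φ (x - v - x) ℕ.* (ψ (s - v) ℕ.* ψ (x - v - (s - v))))
      ≡⟨ sum-cong-≗ (λ x → sum-cong-≗ λ v → ∑-shift v (λ y → φ x ℕ.* φ (x - v - x) ℕ.* (ψ y ℕ.* ψ (x - v - y)))) ⟨
    ∑ (λ x → ∑ λ v → ∑ λ y → φ x ℕ.* φ (x - v - x) ℕ.* (ψ y ℕ.* ψ (x - v - y)))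
      ≡⟨ sum-cong-≗ (λ x → ∑-reflect x (λ t → ∑ λ y → φ x ℕ.* φ (t - x) ℕ.* (ψ y ℕ.* ψ (t - y)))) ⟨
    ∑ (λ x → ∑ λ t → ∑ λ y → φ x ℕ.* φ (t - x) ℕ.* (ψ y ℕ.* ψ (t - y)))
      ≡⟨ ∑-comm (λ x t → ∑ λ y → φ x ℕ.* φ (t - x) ℕ.* (ψ y ℕ.* ψ (t - y))) ⟩
    ∑ (λ t → ∑ λ x → ∑ λ y → φ x ℕ.* φ (t - x) ℕ.* (ψ y ℕ.* ψ (t - y)))
      ≡⟨ sum-cong-≗ (λ t → sum-*-sum (λ x → φ x ℕ.* φ (t - x)) (λ y → ψ y ℕ.* ψ (t - y))) ⟨
    ∑ (λ t → conv φ φ t ℕ.* conv ψ ψ t) ∎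
    where
    open ≡-Reasoning
    pointwise : ∀ x v s → φ x ℕ.* ψ (s - x) ℕ.* (φ v ℕ.* ψ (s - v)) ≡ φ x ℕ.* φ (x - v - x) ℕ.* (ψ (s - v) ℕ.* ψ (x - v - (s - v)))
    pointwise x v s = begin
      φ x ℕ.* ψ (s - x) ℕ.* (φ v ℕ.* ψ (s - v))
        ≡⟨ ℕSolver.solve 4 (λ a b c d → a ℕSolver.:* b ℕSolver.:* (c ℕSolver.:* d) ℕSolver.:= a ℕSolver.:* c ℕSolver.:* (d ℕSolver.:* b)) refl (φ x) (ψ (s - x)) (φ v) (ψ (s - v)) ⟩
      φ x ℕ.* φ v ℕ.* (ψ (s - v) ℕ.* ψ (s - x))
        ≡⟨ cong₂ (λ a b → φ x ℕ.* a ℕ.* (ψ (s - v) ℕ.* b))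
             (trans (cong φ (solve 2 (λ x v → x :- v :- x := :- v) refl x v)) (φ-even v))
             (trans (cong ψ (solve 3 (λ x v s → x :- v :- (s :- v) := :- (s :- x)) refl x v s)) (ψ-even (s - x))) ⟨
      φ x ℕ.* φ (x - v - x) ℕ.* (ψ (s - v) ℕ.* ψ (x - v - (s - v))) ∎

  -- The number of ways to write t as x + y with x ∈ a⁻¹T and y ∈ b⁻¹T.
  R : Fin p → Fin p → Fin p → ℕ
  R a b = conv (λ x → χ (a * x)) (λ x → χ (b * x))

  -- As -1 is a cube, the equation x + y = 1 may be read as a difference, and these are the
  -- classical cyclotomic numbers.
  ν : Fin p → Fin p → ℕ
  ν a b = R a b 1#

  R-comm : ∀ a b t → R a b t ≡ R b a t
  R-comm a b t = trans (∑-reflect t (λ x → χ (a * x) ℕ.* χ (b * (t - x)))) (sum-cong-≗ λ x →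
    trans (ℕ.*-comm (χ (a * (t - x))) _) (cong (λ y → χ (b * y) ℕ.* χ (a * (t - x))) (solve 2 (λ t x → t :- (t :- x) := x) refl t x)))

  R-scale : ∀ {u} → u ≢ 0# → ∀ a b t → R a b (u * t) ≡ R (a * u) (b * u) t
  R-scale {u} u≢0 a b t = trans (∑-scale u≢0 (λ x → χ (a * x) ℕ.* χ (b * (u * t - x)))) (sum-cong-≗ λ x →
    cong₂ (λ y z → χ y ℕ.* χ z) (sym (*-assoc a u x)) (solve 4 (λ b u t x → b :* (u :* t :- u :* x) := b :* u :* (t :- x)) refl b u t x))

  -- Dividing x + y = u by u turns every value of `R` away from 0 into a cyclotomic number.
  R-at : ∀ {u} → u ≢ 0# → ∀ a b → R a b u ≡ ν (a * u) (b * u)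
  R-at {u} u≢0 a b = trans (cong (R a b) (sym (*-identityʳ u))) (R-scale u≢0 a b 1#)

  R-Cubeˡ : ∀ {c} → Cube c → ∀ a b t → R (c * a) b t ≡ R a b t
  R-Cubeˡ {c} C a b t = sum-cong-≗ λ x → cong (ℕ._* χ (b * (t - x))) (trans (cong χ (*-assoc c a x)) (χ-* C (a * x)))

  R-Cubeʳ : ∀ {c} → Cube c → ∀ a b t → R a (c * b) t ≡ R a b t
  R-Cubeʳ {c} C a b t = sum-cong-≗ λ x → cong (χ (a * x) ℕ.*_) (trans (cong χ (*-assoc c b (t - x))) (χ-* C (b * (t - x))))

  R-Cube : ∀ {c} → Cube c → ∀ a b t → R a b (c * t) ≡ R a b t
  R-Cube {c} C a b t = begin
    R a b (c * t)            ≡⟨ R-scale (Cube⇒≢0 C) a b t ⟩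
    R (a * c) (b * c) t      ≡⟨ cong₂ (λ a b → R a b t) (*-comm a c) (*-comm b c) ⟩
    R (c * a) (c * b) t      ≡⟨ R-Cubeˡ C a (c * b) t ⟩
    R a (c * b) t            ≡⟨ R-Cubeʳ C a b t ⟩
    R a b t                  ∎
    where open ≡-Reasoning

  -- The substitution x ↦ 1/x.
  ν-⁻¹ : ∀ {a} b → a ≢ 0# → ν a b ≡ ν (a * a) (a * a * b)
  ν-⁻¹ {a} b a≢0 = trans (∑-⁻¹ (λ x → χ (a * x) ℕ.* χ (b * (1# - x)))) (sum-cong-≗ pointwise)
    where
    open ≡-Reasoning
    pointwise : ∀ x → χ (a * x ⁻¹) ℕ.* χ (b * (1# - x ⁻¹)) ≡ χ (a * a * x) ℕ.* χ (a * a * b * (1# - x))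
    pointwise x = case x ≟ 0# of λ where
        (yes x≡0) → *-zeros (vanish a (trans (cong _⁻¹ x≡0) 0⁻¹≡0)) (vanish (a * a) x≡0)
        (no x≢0) → begin
          χ (a * x ⁻¹) ℕ.* χ (b * (1# - x ⁻¹))          ≡⟨ cong (ℕ._* χ (b * (1# - x ⁻¹))) (swap x≢0) ⟩
          χ (a * a * x) ℕ.* χ (b * (1# - x ⁻¹))         ≡⟨ second x≢0 (cube? (a * a * x)) ⟩
          χ (a * a * x) ℕ.* χ (a * a * b * (1# - x))    ∎
      where
      *-zeros : ∀ {i j k l} → i ≡ 0 → j ≡ 0 → i ℕ.* k ≡ j ℕ.* l
      *-zeros refl refl = refl

      vanish : ∀ u {y} → y ≡ 0# → χ (u * y) ≡ 0
      vanish u {y} y≡0 = trans (cong χ (trans (cong (u *_) y≡0) (zeroʳ u))) χ-0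

      product≡ : x ≢ 0# → a * x ⁻¹ * (a * a * x) ≡ cube a
      product≡ x≢0 = begin
        a * x ⁻¹ * (a * a * x)   ≡⟨ solve 3 (λ a x y → a :* y :* (a :* a :* x) := a :* a :* a :* (y :* x)) refl a x (x ⁻¹) ⟩
        cube a * (x ⁻¹ * x)      ≡⟨ cong (cube a *_) (⁻¹-inverseˡ x≢0) ⟩
        cube a * 1#              ≡⟨ *-identityʳ (cube a) ⟩
        cube a                   ∎

      -- The product of the two arguments is the cube a³.
      swap : x ≢ 0# → χ (a * x ⁻¹) ≡ χ (a * a * x)
      swap x≢0 = ι-⇔ (cube? (a * x ⁻¹)) (cube? (a * a * x))
        (λ C → Cube-cancelˡ C (subst Cube (sym (product≡ x≢0)) (Cube-cube a≢0)))
        (λ C → Cube-cancelʳ C (subst Cube (sym (product≡ x≢0)) (Cube-cube a≢0)))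

      -- The second factor matters only where a² x is a cube. There, multiplying b (1 - 1/x) by a² x
      -- does not change its class and gives -a² b (1 - x), whose sign is a cube too.
      second : x ≢ 0# → Dec (Cube (a * a * x)) → χ (a * a * x) ℕ.* χ (b * (1# - x ⁻¹)) ≡ χ (a * a * x) ℕ.* χ (a * a * b * (1# - x))
      second x≢0 (no ¬C) = *-zeros (ι-no (cube? (a * a * x)) ¬C) (ι-no (cube? (a * a * x)) ¬C)
      second x≢0 (yes C) = cong (χ (a * a * x) ℕ.*_) (begin
        χ (b * (1# - x ⁻¹))                           ≡⟨ χ-* C (b * (1# - x ⁻¹)) ⟨
        χ (a * a * x * (b * (1# - x ⁻¹)))
          ≡⟨ cong χ (solve 4 (λ a b x y → a :* a :* x :* (b :* (con (pos 1) :- y)) := a :* a :* b :* (x :- y :* x)) refl a b x (x ⁻¹)) ⟩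
        χ (a * a * b * (x - x ⁻¹ * x))                ≡⟨ cong (λ z → χ (a * a * b * (x - z))) (⁻¹-inverseˡ x≢0) ⟩
        χ (a * a * b * (x - 1#))
          ≡⟨ cong χ (solve 3 (λ a b x → a :* a :* b :* (x :- con (pos 1)) := :- (a :* a :* b :* (con (pos 1) :- x))) refl a b x) ⟩
        χ (- (a * a * b * (1# - x)))                  ≡⟨ χ-neg (a * a * b * (1# - x)) ⟩
        χ (a * a * b * (1# - x))                      ∎)

  module NonCube (g : Fin p) (g≢0 : g ≢ 0#) (¬Cube-g : ¬ Cube g) where

    open Cosets g g≢0 ¬Cube-g public

    g² : Fin p
    g² = g * g

    g²≢0 : g² ≢ 0#
    g²≢0 = *-≢0 g≢0 g≢0

    Cube-g³ : Cube (g² * g)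
    Cube-g³ = Cube-cube g≢0

    coset-cases : ∀ {x} → x ≢ 0# → Cube x ⊎ Cube (g * x) ⊎ Cube (g² * x)
    coset-cases {x} x≢0 = case cube? x of λ where
      (yes C) → inj₁ C
      (no ¬C) → case cube? (g * x) of λ where
        (yes D) → inj₂ (inj₁ D)
        (no ¬D) → case cube? (g² * x) of λ where
          (yes E) → inj₂ (inj₂ E)
          (no ¬E) → case trans (sym (coset-count≡1 x))
            (cong₂ ℕ._+_ (cong₂ ℕ._+_ (cong₂ ℕ._+_ (ι-no (cube? x) ¬C) (ι-no (cube? (g * x)) ¬D)) (ι-no (cube? (g² * x)) ¬E)) (ι-no (x ≟ 0#) x≢0)) of λ ()

    same-coset : ∀ {e x y} → e ≢ 0# → Cube (e * x) → Cube (e * y) → ∃[ c ] (Cube c × x ≡ c * y)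
    same-coset {e} {x} {y} e≢0 X Y = e * x * (e * y) ⁻¹ , Cube-* X (Cube-⁻¹ Y) , *-cancelˡ e≢0 (begin
      e * x                                ≡⟨ *-identityʳ (e * x) ⟨
      e * x * 1#                           ≡⟨ cong (e * x *_) (⁻¹-inverseˡ (Cube⇒≢0 Y)) ⟨
      e * x * ((e * y) ⁻¹ * (e * y))
        ≡⟨ solve 4 (λ e x y i → e :* x :* (i :* (e :* y)) := e :* (e :* x :* i :* y)) refl e x y ((e * y) ⁻¹) ⟩
      e * (e * x * (e * y) ⁻¹ * y)         ∎)
      where open ≡-Reasoning

    Cube-gg² : Cube (g * g²)
    Cube-gg² = subst Cube (*-comm g² g) Cube-g³

    coset-elim : ∀ {ℓ} (P : Fin p → Set ℓ) → (∀ {c} x → Cube c → P x → P (c * x)) → P 1# → P g → P g² → ∀ {x} → x ≢ 0# → P x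
    coset-elim P resp P1 Pg Pg² {x} x≢0 = case coset-cases x≢0 of λ where
      (inj₁ C)        → subst P (*-identityʳ x) (resp 1# C P1)
      -- `g * x` is a cube exactly when x lies in the class of `g²`, because `g * g²` is a cube.
      (inj₂ (inj₁ C)) → case same-coset g≢0 C Cube-gg² of λ where
        (c , D , eq) → subst P (sym eq) (resp g² D Pg²)
      (inj₂ (inj₂ C)) → case same-coset g²≢0 C Cube-g³ of λ where
        (c , D , eq) → subst P (sym eq) (resp g D Pg)

    ∑-χ* : ∀ {e} → e ≢ 0# → ∑ (λ x → χ (e * x)) ≡ f
    ∑-χ* e≢0 = sym (∑-scale e≢0 χ)

    ∑-by-cosets : ∀ F → (∀ {c} t → Cube c → F (c * t) ≡ F t) → ∑ F ≡ f ℕ.* (F 1# ℕ.+ F g ℕ.+ F g²) ℕ.+ F 0#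
    ∑-by-cosets F inv = begin
      ∑ F
        ≡⟨ sum-cong-≗ pointwise ⟩
      -- `χ (g * t)` selects the class of `g²` and `χ (g² * t)` that of `g`, hence the crossed
      -- values of F.
      ∑ (λ t → F 1# ℕ.* χ t ℕ.+ F g² ℕ.* χ (g * t) ℕ.+ F g ℕ.* χ (g² * t) ℕ.+ ι (t ≟ 0#) ℕ.* F t)
        ≡⟨ ∑-distrib-+ (λ t → F 1# ℕ.* χ t ℕ.+ F g² ℕ.* χ (g * t) ℕ.+ F g ℕ.* χ (g² * t)) (λ t → ι (t ≟ 0#) ℕ.* F t) ⟩
      ∑ (λ t → F 1# ℕ.* χ t ℕ.+ F g² ℕ.* χ (g * t) ℕ.+ F g ℕ.* χ (g² * t)) ℕ.+ ∑ (λ t → ι (t ≟ 0#) ℕ.* F t)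
        ≡⟨ cong₂ ℕ._+_ (∑-distrib-+ (λ t → F 1# ℕ.* χ t ℕ.+ F g² ℕ.* χ (g * t)) (λ t → F g ℕ.* χ (g² * t))) (sum-ι≟ 0# F) ⟩
      ∑ (λ t → F 1# ℕ.* χ t ℕ.+ F g² ℕ.* χ (g * t)) ℕ.+ ∑ (λ t → F g ℕ.* χ (g² * t)) ℕ.+ F 0#
        ≡⟨ cong (λ s → s ℕ.+ ∑ (λ t → F g ℕ.* χ (g² * t)) ℕ.+ F 0#) (∑-distrib-+ (λ t → F 1# ℕ.* χ t) (λ t → F g² ℕ.* χ (g * t))) ⟩
      ∑ (λ t → F 1# ℕ.* χ t) ℕ.+ ∑ (λ t → F g² ℕ.* χ (g * t)) ℕ.+ ∑ (λ t → F g ℕ.* χ (g² * t)) ℕ.+ F 0#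
        ≡⟨ cong (ℕ._+ F 0#) (cong₂ ℕ._+_ (cong₂ ℕ._+_ (sym (*-distribˡ-sum (F 1#) χ)) (pull-out (F g²) g≢0)) (pull-out (F g) g²≢0)) ⟩
      F 1# ℕ.* f ℕ.+ F g² ℕ.* f ℕ.+ F g ℕ.* f ℕ.+ F 0#
        ≡⟨ cong (ℕ._+ F 0#) (ℕSolver.solve 4 (λ f a b c → a ℕSolver.:* f ℕSolver.:+ c ℕSolver.:* f ℕSolver.:+ b ℕSolver.:* f ℕSolver.:= f ℕSolver.:* (a ℕSolver.:+ b ℕSolver.:+ c)) refl f (F 1#) (F g) (F g²)) ⟩
      f ℕ.* (F 1# ℕ.+ F g ℕ.+ F g²) ℕ.+ F 0# ∎
      where
      open ≡-Reasoning
      pull-out : ∀ k {e} → e ≢ 0# → ∑ (λ t → k ℕ.* χ (e * t)) ≡ k ℕ.* f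
      pull-out k {e} e≢0 = trans (sym (*-distribˡ-sum k (λ t → χ (e * t)))) (cong (k ℕ.*_) (∑-χ* e≢0))
      on-coset : ∀ {e r} t → e ≢ 0# → Cube (e * r) → χ (e * t) ℕ.* F t ≡ F r ℕ.* χ (e * t)
      on-coset {e} {r} t e≢0 E = case cube? (e * t) of λ where
          (no ¬T) → trans (cong (ℕ._* F t) (ι-no (cube? (e * t)) ¬T)) (sym (trans (cong (F r ℕ.*_) (ι-no (cube? (e * t)) ¬T)) (ℕ.*-zeroʳ (F r))))
          (yes T) → case same-coset e≢0 T E of λ where
            (c , C , eq) → trans (ℕ.*-comm (χ (e * t)) (F t)) (cong (ℕ._* χ (e * t)) (trans (cong F eq) (inv r C)))
      pointwise : ∀ t → F t ≡ F 1# ℕ.* χ t ℕ.+ F g² ℕ.* χ (g * t) ℕ.+ F g ℕ.* χ (g² * t) ℕ.+ ι (t ≟ 0#) ℕ.* F t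
      pointwise t = begin
        F t                        ≡⟨ ℕ.*-identityˡ (F t) ⟨
        1 ℕ.* F t                  ≡⟨ cong (ℕ._* F t) (coset-count≡1 t) ⟨
        coset-count t ℕ.* F t
          ≡⟨ ℕSolver.solve 5 (λ a b c d e → (a ℕSolver.:+ b ℕSolver.:+ c ℕSolver.:+ d) ℕSolver.:* e ℕSolver.:= a ℕSolver.:* e ℕSolver.:+ b ℕSolver.:* e ℕSolver.:+ c ℕSolver.:* e ℕSolver.:+ d ℕSolver.:* e)
               refl (χ t) (χ (g * t)) (χ (g² * t)) (ι (t ≟ 0#)) (F t) ⟩
        χ t ℕ.* F t ℕ.+ χ (g * t) ℕ.* F t ℕ.+ χ (g² * t) ℕ.* F t ℕ.+ ι (t ≟ 0#) ℕ.* F t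
          ≡⟨ cong (ℕ._+ ι (t ≟ 0#) ℕ.* F t) (cong₂ ℕ._+_ (cong₂ ℕ._+_
               (subst (λ s → χ s ℕ.* F t ≡ F 1# ℕ.* χ s) (*-identityˡ t) (on-coset t 1≢0 (Cube-* Cube-1 Cube-1)))
               (on-coset t g≢0 Cube-gg²)) (on-coset t g²≢0 Cube-g³)) ⟩
        F 1# ℕ.* χ t ℕ.+ F g² ℕ.* χ (g * t) ℕ.+ F g ℕ.* χ (g² * t) ℕ.+ ι (t ≟ 0#) ℕ.* F t ∎

    -- By the symmetries of ν, every cyclotomic number of order 3 is one of these four.
    A B C D : ℕ
    A = ν 1# 1#
    B = ν 1# g
    C = ν 1# g²
    D = ν g g²

    -- For each x in a⁻¹T the element 1 - x lies in exactly one of the three cosets or is 0. The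
    -- latter means x = 1, which is counted by `χ a`.
    ν-row : ∀ {a} → a ≢ 0# → ν a 1# ℕ.+ ν a g ℕ.+ ν a g² ℕ.+ χ a ≡ f
    ν-row {a} a≢0 = begin
      ν a 1# ℕ.+ ν a g ℕ.+ ν a g² ℕ.+ χ a
        ≡⟨ cong (ν a 1# ℕ.+ ν a g ℕ.+ ν a g² ℕ.+_) last-term ⟩
      ν a 1# ℕ.+ ν a g ℕ.+ ν a g² ℕ.+ ∑ (λ x → X x ℕ.* ι (1# - x ≟ 0#))
        ≡⟨ cong (λ s → s ℕ.+ ν a g² ℕ.+ ∑ (λ x → X x ℕ.* ι (1# - x ≟ 0#))) (∑-distrib-+ (λ x → X x ℕ.* χ (1# * (1# - x))) (λ x → X x ℕ.* χ (g * (1# - x)))) ⟨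
      ∑ (λ x → X x ℕ.* χ (1# * (1# - x)) ℕ.+ X x ℕ.* χ (g * (1# - x))) ℕ.+ ν a g² ℕ.+ ∑ (λ x → X x ℕ.* ι (1# - x ≟ 0#))
        ≡⟨ cong (ℕ._+ ∑ (λ x → X x ℕ.* ι (1# - x ≟ 0#))) (∑-distrib-+ (λ x → X x ℕ.* χ (1# * (1# - x)) ℕ.+ X x ℕ.* χ (g * (1# - x))) (λ x → X x ℕ.* χ (g² * (1# - x)))) ⟨
      ∑ (λ x → X x ℕ.* χ (1# * (1# - x)) ℕ.+ X x ℕ.* χ (g * (1# - x)) ℕ.+ X x ℕ.* χ (g² * (1# - x))) ℕ.+ ∑ (λ x → X x ℕ.* ι (1# - x ≟ 0#))
        ≡⟨ ∑-distrib-+ (λ x → X x ℕ.* χ (1# * (1# - x)) ℕ.+ X x ℕ.* χ (g * (1# - x)) ℕ.+ X x ℕ.* χ (g² * (1# - x))) (λ x → X x ℕ.* ι (1# - x ≟ 0#)) ⟨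
      ∑ (λ x → X x ℕ.* χ (1# * (1# - x)) ℕ.+ X x ℕ.* χ (g * (1# - x)) ℕ.+ X x ℕ.* χ (g² * (1# - x)) ℕ.+ X x ℕ.* ι (1# - x ≟ 0#))
        ≡⟨ sum-cong-≗ pointwise ⟩
      ∑ X
        ≡⟨ ∑-χ* a≢0 ⟩
      f ∎
      where
      open ≡-Reasoning
      X : Fin p → ℕ
      X x = χ (a * x)
      last-term : χ a ≡ ∑ (λ x → X x ℕ.* ι (1# - x ≟ 0#))
      last-term = begin
        χ a                                     ≡⟨ cong χ (*-identityʳ a) ⟨
        χ (a * 1#)                              ≡⟨ sum-ι≟ 1# X ⟨
        ∑ (λ x → ι (x ≟ 1#) ℕ.* X x)            ≡⟨ sum-cong-≗ (λ x → trans (ℕ.*-comm (ι (x ≟ 1#)) (X x)) (cong (X x ℕ.*_)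
                                                    (ι-⇔ (x ≟ 1#) (1# - x ≟ 0#) (λ e → trans (cong (λ y → 1# - y) e) (-‿inverseʳ 1#)) (sym ∘ x-y≡0⇒x≡y)))) ⟩
        ∑ (λ x → X x ℕ.* ι (1# - x ≟ 0#))       ∎
      pointwise : ∀ x → X x ℕ.* χ (1# * (1# - x)) ℕ.+ X x ℕ.* χ (g * (1# - x)) ℕ.+ X x ℕ.* χ (g² * (1# - x)) ℕ.+ X x ℕ.* ι (1# - x ≟ 0#) ≡ X x
      pointwise x = begin
        X x ℕ.* χ (1# * y) ℕ.+ X x ℕ.* χ (g * y) ℕ.+ X x ℕ.* χ (g² * y) ℕ.+ X x ℕ.* ι (y ≟ 0#)
          ≡⟨ cong (λ z → X x ℕ.* χ z ℕ.+ X x ℕ.* χ (g * y) ℕ.+ X x ℕ.* χ (g² * y) ℕ.+ X x ℕ.* ι (y ≟ 0#)) (*-identityˡ y) ⟩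
        X x ℕ.* χ y ℕ.+ X x ℕ.* χ (g * y) ℕ.+ X x ℕ.* χ (g² * y) ℕ.+ X x ℕ.* ι (y ≟ 0#)
          ≡⟨ ℕSolver.solve 5 (λ a b c d e → e ℕSolver.:* a ℕSolver.:+ e ℕSolver.:* b ℕSolver.:+ e ℕSolver.:* c ℕSolver.:+ e ℕSolver.:* d ℕSolver.:= e ℕSolver.:* (a ℕSolver.:+ b ℕSolver.:+ c ℕSolver.:+ d))
               refl (χ y) (χ (g * y)) (χ (g² * y)) (ι (y ≟ 0#)) (X x) ⟩
        X x ℕ.* coset-count y   ≡⟨ cong (X x ℕ.*_) (coset-count≡1 y) ⟩
        X x ℕ.* 1               ≡⟨ ℕ.*-identityʳ (X x) ⟩
        X x                     ∎
        where y = 1# - x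

    ν-g1 : ν g 1# ≡ B
    ν-g1 = R-comm g 1# 1#

    ν-g²1 : ν g² 1# ≡ C
    ν-g²1 = R-comm g² 1# 1#

    -- Inversion takes the pair (g², 1) to (g⁴, g⁴), and the cube g³ cancels from both entries.
    ν-gg : ν g g ≡ C
    ν-gg = begin
      ν g g                             ≡⟨ R-Cubeˡ Cube-g³ g g 1# ⟨
      ν (g² * g * g) g                  ≡⟨ R-Cubeʳ Cube-g³ (g² * g * g) g 1# ⟨
      ν (g² * g * g) (g² * g * g)       ≡⟨ cong₂ ν (*-assoc g² g g) (trans (*-assoc g² g g) (sym (*-identityʳ (g² * g²)))) ⟩
      ν (g² * g²) (g² * g² * 1#)        ≡⟨ ν-⁻¹ 1# g²≢0 ⟨
      ν g² 1#                           ≡⟨ ν-g²1 ⟩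
      C                                 ∎
      where open ≡-Reasoning

    ν-g²g² : ν g² g² ≡ B
    ν-g²g² = begin
      ν g² g²           ≡⟨ cong (ν g²) (*-identityʳ g²) ⟨
      ν g² (g² * 1#)    ≡⟨ ν-⁻¹ 1# g≢0 ⟨
      ν g 1#            ≡⟨ ν-g1 ⟩
      B                 ∎
      where open ≡-Reasoning

    row₀ : A ℕ.+ B ℕ.+ C ℕ.+ 1 ≡ f
    row₀ = trans (cong (A ℕ.+ B ℕ.+ C ℕ.+_) (sym (ι-yes (cube? 1#) Cube-1))) (ν-row 1≢0)

    row₁ : B ℕ.+ C ℕ.+ D ≡ f
    row₁ = begin
      B ℕ.+ C ℕ.+ D                                ≡⟨ cong₂ (λ i j → i ℕ.+ j ℕ.+ D) ν-g1 ν-gg ⟨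
      ν g 1# ℕ.+ ν g g ℕ.+ ν g g²                  ≡⟨ ℕ.+-identityʳ _ ⟨
      ν g 1# ℕ.+ ν g g ℕ.+ ν g g² ℕ.+ 0            ≡⟨ cong (ν g 1# ℕ.+ ν g g ℕ.+ ν g g² ℕ.+_) (ι-no (cube? g) ¬Cube-g) ⟨
      ν g 1# ℕ.+ ν g g ℕ.+ ν g g² ℕ.+ χ g          ≡⟨ ν-row g≢0 ⟩
      f                                            ∎
      where open ≡-Reasoning

    χ-even : ∀ a x → χ (a * (- x)) ≡ χ (a * x)
    χ-even a x = trans (cong χ (solve 2 (λ a x → a :* (:- x) := :- (a :* x)) refl a x)) (χ-neg (a * x))

    -- In x + y = 0 the term y = -x lies in the coset of x, so every x in a⁻¹T counts. For the same
    -- reason two different cosets give 0 in `R-1g-0`.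
    R-diagonal-0 : ∀ {a} → a ≢ 0# → R a a 0# ≡ f
    R-diagonal-0 {a} a≢0 = trans (sum-cong-≗ pointwise) (∑-χ* a≢0)
      where
      pointwise : ∀ x → χ (a * x) ℕ.* χ (a * (0# - x)) ≡ χ (a * x)
      pointwise x = trans (cong (χ (a * x) ℕ.*_) (trans (cong (λ y → χ (a * y)) (+-identityˡ (- x))) (χ-even a x))) (idempotent (cube? (a * x)))
        where
        idempotent : ∀ {ℓ} {P : Set ℓ} (P? : Dec P) → ι P? ℕ.* ι P? ≡ ι P?
        idempotent (yes _) = refl
        idempotent (no _)  = refl

    R-1g-0 : R 1# g 0# ≡ 0
    R-1g-0 = sum-zero _ λ x → trans (cong₂ ℕ._*_ (cong χ (*-identityˡ x)) (trans (cong (λ y → χ (g * y)) (+-identityˡ (- x))) (χ-even g x))) (pointwise x (cube? x))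
      where
      pointwise : ∀ x → Dec (Cube x) → χ x ℕ.* χ (g * x) ≡ 0
      pointwise x (no ¬X) = cong (ℕ._* χ (g * x)) (ι-no (cube? x) ¬X)
      pointwise x (yes X) = trans (cong (χ x ℕ.*_) (ι-no (cube? (g * x)) λ G → ¬Cube-g (Cube-cancelʳ X G))) (ℕ.*-zeroʳ (χ x))

    ν-*g³ˡ : ∀ b → ν (g * g²) b ≡ ν 1# b
    ν-*g³ˡ b = trans (cong (λ a → ν a b) (sym (*-identityʳ (g * g²)))) (R-Cubeˡ Cube-gg² 1# b 1#)

    ν-*g³ʳ : ∀ a → ν a (g * g²) ≡ ν a 1#
    ν-*g³ʳ a = trans (cong (ν a) (sym (*-identityʳ (g * g²)))) (R-Cubeʳ Cube-gg² a 1# 1#)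

    -- This and the next five evaluate, at g and g², the two sides of `∑-conv²` for φ the indicator
    -- of T and ψ that of g⁻¹T.
    R-1g-g : R 1# g g ≡ D
    R-1g-g = trans (R-at g≢0 1# g) (cong (λ a → ν a g²) (*-identityˡ g))

    R-1g-g² : R 1# g g² ≡ C
    R-1g-g² = trans (R-at g²≢0 1# g) (trans (cong (λ a → ν a (g * g²)) (*-identityˡ g²)) (trans (ν-*g³ʳ g²) ν-g²1))

    R-11-g : R 1# 1# g ≡ C
    R-11-g = trans (R-at g≢0 1# 1#) (trans (cong₂ ν (*-identityˡ g) (*-identityˡ g)) ν-gg)

    R-11-g² : R 1# 1# g² ≡ B
    R-11-g² = trans (R-at g²≢0 1# 1#) (trans (cong₂ ν (*-identityˡ g²) (*-identityˡ g²)) ν-g²g²)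

    R-gg-g : R g g g ≡ B
    R-gg-g = trans (R-at g≢0 g g) ν-g²g²

    R-gg-g² : R g g g² ≡ A
    R-gg-g² = trans (R-at g²≢0 g g) (trans (ν-*g³ˡ (g * g²)) (ν-*g³ʳ 1#))

    ∑-R*R : ∀ a b c d → ∑ (λ t → R a b t ℕ.* R c d t) ≡
            f ℕ.* (R a b 1# ℕ.* R c d 1# ℕ.+ R a b g ℕ.* R c d g ℕ.+ R a b g² ℕ.* R c d g²) ℕ.+ R a b 0# ℕ.* R c d 0#
    ∑-R*R a b c d = ∑-by-cosets (λ t → R a b t ℕ.* R c d t) λ t E → cong₂ ℕ._*_ (R-Cube E a b t) (R-Cube E c d t)

    -- `∑-conv²` summed coset by coset: each coset of t contributes f equal terms. At t = 0 the
    -- mixed count is 0 and the product of the diagonal ones is f², which supplies the lone f on the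
    -- right once a factor f is cancelled.
    f*quadratic : f ℕ.* (B ℕ.* B ℕ.+ D ℕ.* D ℕ.+ C ℕ.* C) ≡ f ℕ.* (f ℕ.+ (A ℕ.* C ℕ.+ C ℕ.* B ℕ.+ B ℕ.* A))
    f*quadratic = begin
      f ℕ.* (B ℕ.* B ℕ.+ D ℕ.* D ℕ.+ C ℕ.* C)
        ≡⟨ ℕ.+-identityʳ _ ⟨
      f ℕ.* (B ℕ.* B ℕ.+ D ℕ.* D ℕ.+ C ℕ.* C) ℕ.+ 0 ℕ.* 0
        ≡⟨ cong₂ (λ x y → f ℕ.* (B ℕ.* B ℕ.+ x ℕ.* x ℕ.+ y ℕ.* y) ℕ.+ 0 ℕ.* 0) R-1g-g R-1g-g² ⟨
      f ℕ.* (B ℕ.* B ℕ.+ R 1# g g ℕ.* R 1# g g ℕ.+ R 1# g g² ℕ.* R 1# g g²) ℕ.+ 0 ℕ.* 0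
        ≡⟨ cong (λ z → f ℕ.* (B ℕ.* B ℕ.+ R 1# g g ℕ.* R 1# g g ℕ.+ R 1# g g² ℕ.* R 1# g g²) ℕ.+ z ℕ.* z) R-1g-0 ⟨
      f ℕ.* (B ℕ.* B ℕ.+ R 1# g g ℕ.* R 1# g g ℕ.+ R 1# g g² ℕ.* R 1# g g²) ℕ.+ R 1# g 0# ℕ.* R 1# g 0#
        ≡⟨ ∑-R*R 1# g 1# g ⟨
      ∑ (λ t → R 1# g t ℕ.* R 1# g t)
        ≡⟨ ∑-conv² (χ-even 1#) (χ-even g) ⟩
      ∑ (λ t → R 1# 1# t ℕ.* R g g t)
        ≡⟨ ∑-R*R 1# 1# g g ⟩
      f ℕ.* (A ℕ.* R g g 1# ℕ.+ R 1# 1# g ℕ.* R g g g ℕ.+ R 1# 1# g² ℕ.* R g g g²) ℕ.+ R 1# 1# 0# ℕ.* R g g 0#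
        ≡⟨ cong₂ (λ x y → f ℕ.* x ℕ.+ y)
             (cong₂ ℕ._+_ (cong₂ ℕ._+_ (cong (A ℕ.*_) ν-gg) (cong₂ ℕ._*_ R-11-g R-gg-g)) (cong₂ ℕ._*_ R-11-g² R-gg-g²))
             (cong₂ ℕ._*_ (R-diagonal-0 1≢0) (R-diagonal-0 g≢0)) ⟩
      f ℕ.* (A ℕ.* C ℕ.+ C ℕ.* B ℕ.+ B ℕ.* A) ℕ.+ f ℕ.* f
        ≡⟨ ℕ.*-distribˡ-+ f (A ℕ.* C ℕ.+ C ℕ.* B ℕ.+ B ℕ.* A) f ⟨
      f ℕ.* (A ℕ.* C ℕ.+ C ℕ.* B ℕ.+ B ℕ.* A ℕ.+ f)
        ≡⟨ cong (f ℕ.*_) (ℕ.+-comm _ f) ⟩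
      f ℕ.* (f ℕ.+ (A ℕ.* C ℕ.+ C ℕ.* B ℕ.+ B ℕ.* A)) ∎
      where open ≡-Reasoning

    -- Cubes may be dropped from both arguments, so nine pairs of representatives remain, and each
    -- of them gives A, B, C or D.
    ν≢0 : 6 ≤ f → ∀ {a b} → a ≢ 0# → b ≢ 0# → ν a b ≢ 0
    ν≢0 6≤f {a} {b} a≢0 b≢0 = coset-elim (λ a → ν a b ≢ 0) (λ x E → subst (_≢ 0) (sym (R-Cubeˡ E x b 1#)))
        (column 1# N.a≢0 N.b≢0 N.c≢0)
        (column g (subst (_≢ 0) (sym ν-g1) N.b≢0) (subst (_≢ 0) (sym ν-gg) N.c≢0) N.d≢0)
        (column g² (subst (_≢ 0) (sym ν-g²1) N.c≢0) (subst (_≢ 0) (R-comm g g² 1#) N.d≢0) (subst (_≢ 0) (sym ν-g²g²) N.b≢0))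
        a≢0
      where
      instance
        f≢0 : NonZero f
        f≢0 = ℕ.>-nonZero (ℕ.≤-trans (s≤s z≤n) 6≤f)
      module N = CyclotomicNumbers A B C D f row₀ row₁ (ℕ.*-cancelˡ-≡ _ _ f f*quadratic) 6≤f
      column : ∀ a → ν a 1# ≢ 0 → ν a g ≢ 0 → ν a g² ≢ 0 → ν a b ≢ 0
      column a n₁ n₂ n₃ = coset-elim (λ b → ν a b ≢ 0) (λ x E → subst (_≢ 0) (sym (R-Cubeʳ E a x 1#))) n₁ n₂ n₃ b≢0

    -- Normalise z = -1 and split c as c t + c (1 - t). What is needed is a t for which c t / a and
    -- c (1 - t) / b are both cubes, and ν (c/a) (c/b) counts these.
    ternary : 6 ≤ f → ∀ {a b c} → a ≢ 0# → b ≢ 0# → c ≢ 0# →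
              ∃[ x ] ∃[ y ] ∃[ z ] (x ≢ 0# × y ≢ 0# × z ≢ 0# × cube x * a + cube y * b + cube z * c ≡ 0#)
    ternary 6≤f {a} {b} {c} a≢0 b≢0 c≢0 = case sum≢0⇒∃ _ (ν≢0 6≤f (*-≢0 (⁻¹-≢0 a≢0) c≢0) (*-≢0 (⁻¹-≢0 b≢0) c≢0)) of λ where
        (t , ≢0) → case ι≢0⇒ (cube? _) (λ e → ≢0 (cong (ℕ._* χ (b ⁻¹ * c * (1# - t))) e)) ,
                        ι≢0⇒ (cube? _) (λ e → ≢0 (trans (cong (χ (a ⁻¹ * c * t) ℕ.*_) e) (ℕ.*-zeroʳ (χ (a ⁻¹ * c * t))))) of λ where
          ((x , x≢0 , eq₁) , (y , y≢0 , eq₂)) → x , y , - 1# , x≢0 , y≢0 , -‿≢0 1≢0 , (begin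
            cube x * a + cube y * b + cube (- 1#) * c                          ≡⟨ cong₂ (λ u v → u * a + v * b + cube (- 1#) * c) eq₁ eq₂ ⟩
            a ⁻¹ * c * t * a + b ⁻¹ * c * (1# - t) * b + cube (- 1#) * c       ≡⟨ rearrange a b c t (a ⁻¹) (b ⁻¹) ⟩
            a ⁻¹ * a * (c * t) + b ⁻¹ * b * (c * (1# - t)) - c
              ≡⟨ cong₂ (λ u v → u * (c * t) + v * (c * (1# - t)) - c) (⁻¹-inverseˡ a≢0) (⁻¹-inverseˡ b≢0) ⟩
            1# * (c * t) + 1# * (c * (1# - t)) - c
              ≡⟨ solve 2 (λ c t → con (pos 1) :* (c :* t) :+ con (pos 1) :* (c :* (con (pos 1) :- t)) :- c := con (pos 0)) refl c t ⟩
            0#                                                                 ∎)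
      where
      open ≡-Reasoning
      rearrange : ∀ a b c t i j → i * c * t * a + j * c * (1# - t) * b + cube (- 1#) * c ≡ i * a * (c * t) + j * b * (c * (1# - t)) - c
      rearrange = solve 6 (λ a b c t i j → i :* c :* t :* a :+ j :* c :* (con (pos 1) :- t) :* b :+ ((:- con (pos 1)) :* (:- con (pos 1)) :* (:- con (pos 1))) :* c
        := i :* a :* (c :* t) :+ j :* b :* (c :* (con (pos 1) :- t)) :- c) refl

-- Weighted sums and the Chinese remainder theorem

-- t = ∑ bᵢ³ xᵢ with every bᵢ coprime to m: a weight in T_m is carried by one of its cube roots, and nothing is reduced mod m.
data Weighted (m : ℕ) : List ℕ → ℕ → Set where
  []   : Weighted m [] 0
  cons : ∀ {x S t s} b → Coprime b m → Weighted m S t → s ≡ b ^ 3 ℕ.* x ℕ.+ t → Weighted m (x ∷ S) s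

ZeroSum : ℕ → List ℕ → Set
ZeroSum m S = ∃[ t ] (Weighted m S t × m ∣ t)

Coprime-* : ∀ {a m n} → Coprime a m → Coprime a n → Coprime a (m ℕ.* n)
Coprime-* {a} {m} {n} a⊥m a⊥n {k} (k∣a , k∣mn) =
  a⊥n (k∣a , coprime-divisor (λ { (d∣k , d∣m) → a⊥m (ℕ.∣-trans d∣k k∣a , d∣m) }) k∣mn)

Coprime-*ˡ : ∀ {a b m} → Coprime a m → Coprime b m → Coprime (a ℕ.* b) m
Coprime-*ˡ a⊥m b⊥m = Coprime.sym (Coprime-* (Coprime.sym a⊥m) (Coprime.sym b⊥m))

Weighted-scale : ∀ {m S t} b → Coprime b m → Weighted m S t → Weighted m S (b ^ 3 ℕ.* t)
Weighted-scale {m} b b⊥m []             = subst (Weighted m []) (sym (ℕ.*-zeroʳ (b ^ 3))) []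
Weighted-scale {m} b b⊥m (cons {x} {t = t} c c⊥m w refl) = cons (b ℕ.* c) (Coprime-*ˡ b⊥m c⊥m) (Weighted-scale b b⊥m w)
  (solve 4 (λ b c x t → b :^ 3 :* (c :^ 3 :* x :+ t) := (b :* c) :^ 3 :* x :+ b :^ 3 :* t) refl b c x t)
  where open ℕSolver

-- Supplies weights modulo a factor where the value of the sum does not matter.
Weighted-all-ones : ∀ m S → ∃[ t ] Weighted m S t
Weighted-all-ones m []      = 0 , []
Weighted-all-ones m (x ∷ S) = _ , cons 1 (Coprime.1-coprimeTo m) (proj₂ (Weighted-all-ones m S)) refl

module Congruence (m : ℕ) .{{_ : NonZero m}} where

  open Residues m public

  ⟦_⟧ₙ : ℕ → Fin m
  ⟦ x ⟧ₙ = ⟦ pos x ⟧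

  ⟦⟧-+ : ∀ x y → ⟦ x ℕ.+ y ⟧ₙ ≡ ⟦ x ⟧ₙ + ⟦ y ⟧ₙ
  ⟦⟧-+ x y = +-homo (pos x) (pos y)

  ⟦⟧-* : ∀ x y → ⟦ x ℕ.* y ⟧ₙ ≡ ⟦ x ⟧ₙ * ⟦ y ⟧ₙ
  ⟦⟧-* x y = trans (cong ⟦_⟧ (ℤ.pos-* x y)) (*-homo (pos x) (pos y))

  ⟦⟧-cube : ∀ b → ⟦ b ^ 3 ⟧ₙ ≡ ⟦ b ⟧ₙ * ⟦ b ⟧ₙ * ⟦ b ⟧ₙ
  ⟦⟧-cube b = trans (cong ⟦_⟧ₙ (ℕSolver.solve 1 (λ b → b ℕSolver.:^ 3 ℕSolver.:= b ℕSolver.:* b ℕSolver.:* b) refl b))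
    (trans (⟦⟧-* (b ℕ.* b) b) (cong (_* ⟦ b ⟧ₙ) (⟦⟧-* b b)))

  ⟦⟧-term : ∀ a x t → ⟦ a ℕ.* x ℕ.+ t ⟧ₙ ≡ ⟦ a ⟧ₙ * ⟦ x ⟧ₙ + ⟦ t ⟧ₙ
  ⟦⟧-term a x t = trans (⟦⟧-+ (a ℕ.* x) t) (cong (_+ ⟦ t ⟧ₙ) (⟦⟧-* a x))

  ⟦⟧-% : ∀ x → ⟦ x % m ⟧ₙ ≡ ⟦ x ⟧ₙ
  ⟦⟧-% x = sym (begin
    ⟦ x ⟧ₙ                                  ≡⟨ cong ⟦_⟧ₙ (trans (m≡m%n+[m/n]*n x m) (ℕ.+-comm (x % m) _)) ⟩
    ⟦ x ℕ./ m ℕ.* m ℕ.+ x % m ⟧ₙ            ≡⟨ ⟦⟧-+ (x ℕ./ m ℕ.* m) (x % m) ⟩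
    ⟦ x ℕ./ m ℕ.* m ⟧ₙ + ⟦ x % m ⟧ₙ         ≡⟨ cong (_+ ⟦ x % m ⟧ₙ) (pos∣⇒⟦⟧≡0 (ℕ.n∣m*n (x ℕ./ m))) ⟩
    0# + ⟦ x % m ⟧ₙ                         ≡⟨ +-identityˡ _ ⟩
    ⟦ x % m ⟧ₙ                              ∎)
    where open ≡-Reasoning

  ⟦⟧≡⇒∣ : ∀ {x y} → ⟦ x ⟧ₙ ≡ ⟦ y ⟧ₙ → m ∣ x → m ∣ y
  ⟦⟧≡⇒∣ eq m∣x = ⟦⟧≡0⇒∣ (trans (sym eq) (pos∣⇒⟦⟧≡0 m∣x))

  Coprime-resp-⟦⟧ : ∀ {a b} → ⟦ a ⟧ₙ ≡ ⟦ b ⟧ₙ → Coprime a m → Coprime b m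
  Coprime-resp-⟦⟧ {a} {b} eq a⊥m {k} (k∣b , k∣m) = a⊥m (k∣a , k∣m)
    where
    k∣a : k ∣ a
    k∣a = ℤ.∣⇒∣ᵤ (ℤ.∣m+n∣n⇒∣m {m = pos a} {n = ℤ.- pos b} (ℤ.∣-trans (ℤ.∣ᵤ⇒∣ k∣m) (⟦⟧-cong⁻¹ eq)) (ℤ.∣m⇒∣-m (ℤ.∣ᵤ⇒∣ {pos k} {pos b} k∣b)))

idempotentˡ : ∀ m n .{{_ : NonZero m}} .{{_ : NonZero n}} → Coprime m n →
              ∃[ e ] (Congruence.⟦_⟧ₙ m e ≡ Residues.1# m × Congruence.⟦_⟧ₙ n e ≡ Residues.0# n)
idempotentˡ m n m⊥n = from-Bézout (coprime-Bézout m⊥n)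
  where
  module M = Congruence m
  module N = Congruence n
  open M.Solver using (solve; _:=_; _:+_; _:*_; _:-_; con)
  open ≡-Reasoning
  yn≡0 : ∀ y → N.⟦ y ℕ.* n ⟧ₙ ≡ N.0#
  yn≡0 y = N.pos∣⇒⟦⟧≡0 (ℕ.n∣m*n y)
  xm≡0 : ∀ x → M.⟦ x ℕ.* m ⟧ₙ ≡ M.0#
  xm≡0 x = M.pos∣⇒⟦⟧≡0 (ℕ.n∣m*n x)
  square : ∀ z → M.1# M.+ z ≡ M.0# → z M.* z ≡ M.1#
  square z eq = begin
    z M.* z
      ≡⟨ solve 1 (λ z → z :* z := (con (pos 1) :+ z) :* (z :- con (pos 1)) :+ con (pos 1)) refl z ⟩
    (M.1# M.+ z) M.* (z M.- M.1#) M.+ M.1#              ≡⟨ cong (λ u → u M.* (z M.- M.1#) M.+ M.1#) eq ⟩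
    M.0# M.* (z M.- M.1#) M.+ M.1#
      ≡⟨ solve 1 (λ z → con (pos 0) :* (z :- con (pos 1)) :+ con (pos 1) := con (pos 1)) refl z ⟩
    M.1#                                                ∎

  from-Bézout : Bézout.Identity 1 m n → ∃[ e ] (M.⟦ e ⟧ₙ ≡ M.1# × N.⟦ e ⟧ₙ ≡ N.0#)
  from-Bézout (Bézout.-+ x y eq) = y ℕ.* n , (begin
    M.⟦ y ℕ.* n ⟧ₙ           ≡⟨ cong M.⟦_⟧ₙ eq ⟨
    M.⟦ 1 ℕ.+ x ℕ.* m ⟧ₙ     ≡⟨ M.⟦⟧-+ 1 (x ℕ.* m) ⟩
    M.1# M.+ M.⟦ x ℕ.* m ⟧ₙ  ≡⟨ cong (M.1# M.+_) (xm≡0 x) ⟩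
    M.1# M.+ M.0#            ≡⟨ M.+-comm M.1# M.0# ⟩
    M.0# M.+ M.1#            ≡⟨ M.+-identityˡ M.1# ⟩
    M.1#                     ∎) , yn≡0 y
  -- Here y n ≡ -1 mod m; squaring repairs the sign without leaving ℕ.
  from-Bézout (Bézout.+- x y eq) = y ℕ.* n ℕ.* (y ℕ.* n) ,
    trans (M.⟦⟧-* (y ℕ.* n) (y ℕ.* n)) (square M.⟦ y ℕ.* n ⟧ₙ (begin
      M.1# M.+ M.⟦ y ℕ.* n ⟧ₙ  ≡⟨ M.⟦⟧-+ 1 (y ℕ.* n) ⟨
      M.⟦ 1 ℕ.+ y ℕ.* n ⟧ₙ     ≡⟨ cong M.⟦_⟧ₙ eq ⟩
      M.⟦ x ℕ.* m ⟧ₙ           ≡⟨ xm≡0 x ⟩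
      M.0#                     ∎)) ,
    N.pos∣⇒⟦⟧≡0 (ℕ.∣n⇒∣m*n (y ℕ.* n) (ℕ.n∣m*n y))

module ChineseRemainder (m n : ℕ) .{{_ : NonZero m}} .{{_ : NonZero n}} (m⊥n : Coprime m n) where

  private
    module M = Congruence m
    module N = Congruence n

  crt : ∀ b c → ∃[ d ] (M.⟦ d ⟧ₙ ≡ M.⟦ b ⟧ₙ × N.⟦ d ⟧ₙ ≡ N.⟦ c ⟧ₙ)
  crt b c = case idempotentˡ m n m⊥n , idempotentˡ n m (Coprime.sym m⊥n) of λ where
    ((e , e≡1 , e≡0) , (e′ , e′≡1 , e′≡0)) → b ℕ.* e ℕ.+ c ℕ.* e′ ,
      trans (M.⟦⟧-term b e (c ℕ.* e′)) (trans (cong₂ (λ u v → M.⟦ b ⟧ₙ M.* u M.+ v) e≡1 (trans (M.⟦⟧-* c e′) (cong (M.⟦ c ⟧ₙ M.*_) e′≡0)))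
        (M.Solver.solve 2 (λ b c → b M.Solver.:* M.Solver.con (pos 1) M.Solver.:+ c M.Solver.:* M.Solver.con (pos 0) M.Solver.:= b) refl M.⟦ b ⟧ₙ M.⟦ c ⟧ₙ)) ,
      trans (N.⟦⟧-term b e (c ℕ.* e′)) (trans (cong₂ (λ u v → N.⟦ b ⟧ₙ N.* u N.+ v) e≡0 (trans (N.⟦⟧-* c e′) (cong (N.⟦ c ⟧ₙ N.*_) e′≡1)))
        (N.Solver.solve 2 (λ b c → b N.Solver.:* N.Solver.con (pos 0) N.Solver.:+ c N.Solver.:* N.Solver.con (pos 1) N.Solver.:= c) refl N.⟦ b ⟧ₙ N.⟦ c ⟧ₙ))

  crt-Coprime : ∀ b c → Coprime b m → Coprime c n → ∃[ d ] (Coprime d (m ℕ.* n) × M.⟦ d ⟧ₙ ≡ M.⟦ b ⟧ₙ × N.⟦ d ⟧ₙ ≡ N.⟦ c ⟧ₙ)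
  crt-Coprime b c b⊥m c⊥n = let (d , d≡b , d≡c) = crt b c in
    d , Coprime-* (M.Coprime-resp-⟦⟧ (sym d≡b) b⊥m) (N.Coprime-resp-⟦⟧ (sym d≡c) c⊥n) , d≡b , d≡c

  -- The cube roots are combined, not the weights, so each new weight is again the cube of a unit.
  Weighted-crt : ∀ {S s t} → Weighted m S s → Weighted n S t → ∃[ r ] (Weighted (m ℕ.* n) S r × M.⟦ r ⟧ₙ ≡ M.⟦ s ⟧ₙ × N.⟦ r ⟧ₙ ≡ N.⟦ t ⟧ₙ)
  Weighted-crt [] [] = 0 , [] , refl , refl
  Weighted-crt (cons {x} {t = s} b b⊥m ws refl) (cons {t = t} c c⊥n wt refl) =
    let (d , d⊥mn , d≡b , d≡c) = crt-Coprime b c b⊥m c⊥n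
        (r , wr , r≡s , r≡t)   = Weighted-crt ws wt
    in d ^ 3 ℕ.* x ℕ.+ r , cons d d⊥mn wr refl ,
        (begin
          M.⟦ d ^ 3 ℕ.* x ℕ.+ r ⟧ₙ
            ≡⟨ trans (M.⟦⟧-term (d ^ 3) x r) (cong (λ u → u M.* M.⟦ x ⟧ₙ M.+ M.⟦ r ⟧ₙ) (M.⟦⟧-cube d)) ⟩
          M.⟦ d ⟧ₙ M.* M.⟦ d ⟧ₙ M.* M.⟦ d ⟧ₙ M.* M.⟦ x ⟧ₙ M.+ M.⟦ r ⟧ₙ        ≡⟨ cong₂ (λ u v → u M.* u M.* u M.* M.⟦ x ⟧ₙ M.+ v) d≡b r≡s ⟩
          M.⟦ b ⟧ₙ M.* M.⟦ b ⟧ₙ M.* M.⟦ b ⟧ₙ M.* M.⟦ x ⟧ₙ M.+ M.⟦ s ⟧ₙ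
            ≡⟨ trans (M.⟦⟧-term (b ^ 3) x s) (cong (λ u → u M.* M.⟦ x ⟧ₙ M.+ M.⟦ s ⟧ₙ) (M.⟦⟧-cube b)) ⟨
          M.⟦ b ^ 3 ℕ.* x ℕ.+ s ⟧ₙ                                            ∎) ,
        (begin
          N.⟦ d ^ 3 ℕ.* x ℕ.+ r ⟧ₙ
            ≡⟨ trans (N.⟦⟧-term (d ^ 3) x r) (cong (λ u → u N.* N.⟦ x ⟧ₙ N.+ N.⟦ r ⟧ₙ) (N.⟦⟧-cube d)) ⟩
          N.⟦ d ⟧ₙ N.* N.⟦ d ⟧ₙ N.* N.⟦ d ⟧ₙ N.* N.⟦ x ⟧ₙ N.+ N.⟦ r ⟧ₙ        ≡⟨ cong₂ (λ u v → u N.* u N.* u N.* N.⟦ x ⟧ₙ N.+ v) d≡c r≡t ⟩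
          N.⟦ c ⟧ₙ N.* N.⟦ c ⟧ₙ N.* N.⟦ c ⟧ₙ N.* N.⟦ x ⟧ₙ N.+ N.⟦ t ⟧ₙ
            ≡⟨ trans (N.⟦⟧-term (c ^ 3) x t) (cong (λ u → u N.* N.⟦ x ⟧ₙ N.+ N.⟦ t ⟧ₙ) (N.⟦⟧-cube c)) ⟨
          N.⟦ c ^ 3 ℕ.* x ℕ.+ t ⟧ₙ                                            ∎)
    where open ≡-Reasoning

  *∣ : ∀ {r} → m ∣ r → n ∣ r → m ℕ.* n ∣ r
  *∣ {r} (ℕ.divides q refl) n∣r = subst (_∣ q ℕ.* m) (ℕ.*-comm n m) (ℕ.*-monoˡ-∣ m (coprime-divisor (Coprime.sym m⊥n) (subst (n ∣_) (ℕ.*-comm q m) n∣r)))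

  ZeroSum-crt : ∀ {S} → ZeroSum m S → ZeroSum n S → ZeroSum (m ℕ.* n) S
  ZeroSum-crt (s , ws , m∣s) (t , wt , n∣t) =
    let (r , wr , r≡s , r≡t) = Weighted-crt ws wt in
    r , wr , *∣ (M.⟦⟧≡⇒∣ (sym r≡s) m∣s) (N.⟦⟧≡⇒∣ (sym r≡t) n∣t)

prime∤⇒Coprime : ∀ {p b} → Prime p → ¬ p ∣ b → Coprime b p
prime∤⇒Coprime {p} {b} p-prime p∤b = Coprime-resp-⟦⟧ (⟦⟧-% b)
    (Coprime.sym (prime⇒coprime p-prime {{ℕ.≢-nonZero (p∤b ∘ ℕ.m%n≡0⇒n∣m b p)}} (m%n<n b p)))
  where
  instance
    p≢0 : NonZero p
    p≢0 = PrimeField.p≢0 p p-prime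
  open Congruence p

-- Zero-sum criteria modulo a single prime

nondivisible : ℕ → List ℕ → List ℕ
nondivisible p = filter (λ x → ¬? (p ∣? x))

module Threshold (p : ℕ) (p-prime : Prime p) (p∤2 : ¬ p ∣ 2) where

  open Cyclotomy p p-prime
  open Congruence p using (⟦_⟧ₙ; ⟦⟧-*; ⟦⟧-term; ⟦⟧-cube)
  open Solver using (solve; _:=_; _:+_; _:*_; _:-_; :-_; con)

  Sums : List ℕ → Fin p → Set
  Sums S τ = ∃[ t ] (Weighted p S t × ⟦ t ⟧ₙ ≡ τ)

  toℕ-Coprime : ∀ {b} → b ≢ 0# → Coprime (toℕ b) p
  toℕ-Coprime {b} b≢0 = prime∤⇒Coprime p-prime (λ p∣b → b≢0 (trans (sym (⟦lift⟧ b)) (pos∣⇒⟦⟧≡0 p∣b)))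

  ⟦toℕ⟧-cube : ∀ b → ⟦ toℕ b ^ 3 ⟧ₙ ≡ cube b
  ⟦toℕ⟧-cube b = trans (⟦⟧-cube (toℕ b)) (cong cube (⟦lift⟧ b))

  Sums-∷ : ∀ {S τ} x b → b ≢ 0# → Sums S τ → Sums (x ∷ S) (cube b * ⟦ x ⟧ₙ + τ)
  Sums-∷ x b b≢0 (t , w , refl) = toℕ b ^ 3 ℕ.* x ℕ.+ t , cons (toℕ b) (toℕ-Coprime b≢0) w refl ,
    trans (⟦⟧-term (toℕ b ^ 3) x t) (cong (λ u → u * ⟦ x ⟧ₙ + ⟦ t ⟧ₙ) (⟦toℕ⟧-cube b))

  Sums-scale : ∀ {S τ} b → b ≢ 0# → Sums S τ → Sums S (cube b * τ)
  Sums-scale b b≢0 (t , w , refl) = toℕ b ^ 3 ℕ.* t , Weighted-scale (toℕ b) (toℕ-Coprime b≢0) w ,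
    trans (⟦⟧-* (toℕ b ^ 3) t) (cong (_* ⟦ t ⟧ₙ) (⟦toℕ⟧-cube b))

  Sums-skip : ∀ {S τ x} → p ∣ x → Sums S τ → Sums (x ∷ S) τ
  Sums-skip {S} {τ} {x} p∣x s = subst (Sums (x ∷ S))
    (trans (cong (λ u → cube 1# * u + τ) (pos∣⇒⟦⟧≡0 p∣x)) (solve 1 (λ t → con (pos 1) :* con (pos 1) :* con (pos 1) :* con (pos 0) :+ t := t) refl τ))
    (Sums-∷ x 1# 1≢0 s)

  ∤⇒≢0 : ∀ {x} → ¬ p ∣ x → ⟦ x ⟧ₙ ≢ 0#
  ∤⇒≢0 p∤x eq = p∤x (⟦⟧≡0⇒∣ eq)

  -- One of u = 1 and u = -1 works: if a + b and b - a were both 0, then 2 a = 0, which is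
  -- impossible for odd p.
  merge : ∀ {a b} → a ≢ 0# → ∃[ u ] (u ≢ 0# × cube u * a + b ≢ 0#)
  merge {a} {b} a≢0 = case a + b ≟ 0# of λ where
    (no a+b≢0)  → 1# , 1≢0 , a+b≢0 ∘ trans (solve 2 (λ a b → a :+ b := con (pos 1) :* con (pos 1) :* con (pos 1) :* a :+ b) refl a b)
    (yes a+b≡0) → case b - a ≟ 0# of λ where
      (no b-a≢0)  → - 1# , -‿≢0 1≢0 , b-a≢0 ∘ trans (solve 2 (λ a b → b :- a := (:- con (pos 1)) :* (:- con (pos 1)) :* (:- con (pos 1)) :* a :+ b) refl a b)
      (yes b-a≡0) → contradiction
        (trans (solve 2 (λ a b → con (pos 2) :* a := (a :+ b) :- (b :- a)) refl a b) (trans (cong₂ _-_ a+b≡0 b-a≡0) (-‿inverseʳ 0#)))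
        (*-≢0 (λ 2≡0 → p∤2 (⟦⟧≡0⇒∣ 2≡0)) a≢0)

  nondivisible-cases : ∀ {k} x S → ℕ.suc k ≤ length (nondivisible p (x ∷ S)) →
    (p ∣ x × ℕ.suc k ≤ length (nondivisible p S)) ⊎ (¬ p ∣ x × k ≤ length (nondivisible p S))
  nondivisible-cases x S h with p ∣? x
  ... | yes p∣x = inj₁ (p∣x , h)
  ... | no p∤x  = inj₂ (p∤x , ℕ.s≤s⁻¹ h)

  -- The tail may carry any weights; the sign of one term prime to p then keeps the total away from
  -- 0. This lets a long tail act as a single unit coefficient.
  nonzero-sum : ∀ S → 1 ≤ length (nondivisible p S) → ∃[ τ ] (τ ≢ 0# × Sums S τ)
  nonzero-sum (x ∷ S) h = case nondivisible-cases x S h of λ where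
    (inj₁ (p∣x , h₁)) → case nonzero-sum S h₁ of λ where
      (τ , τ≢0 , s) → τ , τ≢0 , Sums-skip p∣x s
    (inj₂ (p∤x , _)) → case Weighted-all-ones p S of λ where
      (t , w) → case merge {⟦ x ⟧ₙ} {⟦ t ⟧ₙ} (∤⇒≢0 p∤x) of λ where
        (u , u≢0 , ≢0) → _ , ≢0 , Sums-∷ x u u≢0 (t , w , refl)

  Sums-0⇒ZeroSum : ∀ {S} → Sums S 0# → ZeroSum p S
  Sums-0⇒ZeroSum (t , w , eq) = t , w , ⟦⟧≡0⇒∣ eq

  module Ternary (ternary : ∀ {a b c} → a ≢ 0# → b ≢ 0# → c ≢ 0# →
              ∃[ x ] ∃[ y ] ∃[ z ] (x ≢ 0# × y ≢ 0# × z ≢ 0# × cube x * a + cube y * b + cube z * c ≡ 0#)) where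

    -- The tail is the third coefficient of the ternary equation, and the cube of z rescales all its
    -- weights at once. Together with `with-one` this walks along the list to the first two terms
    -- prime to p.
    with-two : ∀ {a b} → a ≢ 0# → b ≢ 0# → ∀ S → 1 ≤ length (nondivisible p S) →
               ∃[ u ] ∃[ v ] ∃[ τ ] (u ≢ 0# × v ≢ 0# × Sums S τ × cube u * a + (cube v * b + τ) ≡ 0#)
    with-two a≢0 b≢0 S h = case nonzero-sum S h of λ where
      (τ , τ≢0 , s) → case ternary a≢0 b≢0 τ≢0 of λ where
        (x , y , z , x≢0 , y≢0 , z≢0 , eq) → x , y , cube z * τ , x≢0 , y≢0 , Sums-scale z z≢0 s , trans (sym (+-assoc _ _ _)) eq

    with-one : ∀ {a} → a ≢ 0# → ∀ S → 2 ≤ length (nondivisible p S) →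
               ∃[ u ] ∃[ τ ] (u ≢ 0# × Sums S τ × cube u * a + τ ≡ 0#)
    with-one a≢0 (x ∷ S) h = case nondivisible-cases x S h of λ where
      (inj₁ (p∣x , h₁)) → case with-one a≢0 S h₁ of λ where
        (u , τ , u≢0 , s , eq) → u , τ , u≢0 , Sums-skip p∣x s , eq
      (inj₂ (p∤x , h₁)) → case with-two a≢0 (∤⇒≢0 p∤x) S h₁ of λ where
        (u , v , τ , u≢0 , v≢0 , s , eq) → u , _ , u≢0 , Sums-∷ x v v≢0 s , eq

    zero-sum : ∀ S → 3 ≤ length (nondivisible p S) → Sums S 0#
    zero-sum (x ∷ S) h = case nondivisible-cases x S h of λ where
      (inj₁ (p∣x , h₁)) → Sums-skip p∣x (zero-sum S h₁)
      (inj₂ (p∤x , h₁)) → case with-one (∤⇒≢0 p∤x) S h₁ of λ where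
        (u , τ , u≢0 , s , eq) → subst (Sums (x ∷ S)) eq (Sums-∷ x u u≢0 s)

  module AllCubes (all-cubes : ∀ {x} → x ≢ 0# → Cube x) where

    -- With τ a nonzero sum of the tail, -τ/x is a unit and hence a cube u³, so u³ x + τ = 0.
    zero-sum : ∀ S → 2 ≤ length (nondivisible p S) → Sums S 0#
    zero-sum (x ∷ S) h = case nondivisible-cases x S h of λ where
        (inj₁ (p∣x , h₁)) → Sums-skip p∣x (zero-sum S h₁)
        (inj₂ (p∤x , h₁)) → case nonzero-sum S h₁ of λ where
          (τ , τ≢0 , s) → case all-cubes (-‿≢0 (*-≢0 τ≢0 (⁻¹-≢0 (∤⇒≢0 p∤x)))) of λ where
            (u , u≢0 , eq) → subst (Sums (x ∷ S)) (solved (∤⇒≢0 p∤x) eq) (Sums-∷ x u u≢0 s)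
      where
      solved : ∀ {a τ c} → a ≢ 0# → c ≡ - (τ * a ⁻¹) → c * a + τ ≡ 0#
      solved {a} {τ} a≢0 refl = begin
        - (τ * a ⁻¹) * a + τ      ≡⟨ solve 3 (λ t i a → (:- (t :* i)) :* a :+ t := t :- t :* (i :* a)) refl τ (a ⁻¹) a ⟩
        τ - τ * (a ⁻¹ * a)        ≡⟨ cong (λ z → τ - τ * z) (⁻¹-inverseˡ a≢0) ⟩
        τ - τ * 1#                ≡⟨ solve 1 (λ t → t :- t :* con (pos 1) := con (pos 0)) refl τ ⟩
        0#                        ∎
        where open ≡-Reasoning

  non-cube? : Dec (∃[ g ] (g ≢ 0# × ¬ Cube g))
  non-cube? = any? λ g → ¬? (g ≟ 0#) ×-dec ¬? (cube? g)

  all-cubes : ¬ (∃[ g ] (g ≢ 0# × ¬ Cube g)) → ∀ {x} → x ≢ 0# → Cube x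
  all-cubes none {x} x≢0 = decidable-stable (cube? x) (λ ¬C → none (x , x≢0 , ¬C))

  -- A noncube would force p = 3 f + 1, so modulo such p every unit is a cube.
  zero-sum₂ : p % 3 ≡ 2 → ∀ S → 2 ≤ length (nondivisible p S) → ZeroSum p S
  zero-sum₂ p%3≡2 S h = case non-cube? of λ where
      (no none)            → Sums-0⇒ZeroSum (AllCubes.zero-sum (all-cubes none) S h)
      (yes (g , g≢0 , ¬C)) → contradiction (trans (sym (p%3≡1 g g≢0 ¬C)) p%3≡2) λ ()
    where
    p%3≡1 : ∀ g g≢0 ¬C → p % 3 ≡ 1
    p%3≡1 g g≢0 ¬C = let open NonCube g g≢0 ¬C in
      trans (cong (_% 3) (trans (sym 3f+1≡p) (trans (ℕ.+-comm (3 ℕ.* f) 1) (cong (1 ℕ.+_) (ℕ.*-comm 3 f))))) ([m+kn]%n≡m%n 1 f 3)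

  zero-sum₃ : ¬ 2 ∣ p → ¬ 7 ∣ p → ¬ 13 ∣ p → ∀ S → 3 ≤ length (nondivisible p S) → ZeroSum p S
  zero-sum₃ 2∤p 7∤p 13∤p S h = Sums-0⇒ZeroSum (case non-cube? of λ where
      (no none)            → AllCubes.zero-sum (all-cubes none) S (ℕ.≤-trans (ℕ.n≤1+n 2) h)
      (yes (g , g≢0 , ¬C)) → let open NonCube g g≢0 ¬C in Ternary.zero-sum (ternary (6≤f f 3f+1≡p)) S h)
    where
    -- For f < 6 the values of p are 1, 4, 7, 10, 13, 16: not prime, even, or one of the two
    -- excluded primes.
    6≤f : ∀ f → 3 ℕ.* f ℕ.+ 1 ≡ p → 6 ≤ f
    6≤f 0 eq = contradiction (subst Prime (sym eq) p-prime) ¬prime[1]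
    6≤f 1 eq = contradiction (ℕ.divides 2 (sym eq)) 2∤p
    6≤f 2 eq = contradiction (ℕ.divides 1 (sym eq)) 7∤p
    6≤f 3 eq = contradiction (ℕ.divides 5 (sym eq)) 2∤p
    6≤f 4 eq = contradiction (ℕ.divides 1 (sym eq)) 13∤p
    6≤f 5 eq = contradiction (ℕ.divides 8 (sym eq)) 2∤p
    6≤f (ℕ.suc (ℕ.suc (ℕ.suc (ℕ.suc (ℕ.suc (ℕ.suc f)))))) eq = s≤s (s≤s (s≤s (s≤s (s≤s (s≤s z≤n)))))

-- Sequences over ℤ_n

mod≡% : ∀ x m .{{_ : NonZero m}} → x mod m ≡ x % m
mod≡% x (ℕ.suc m) = refl

-- `HasWZSSub` with weights carried by their roots; `Correspondence` translates in both directions.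
HasZeroSum : ℕ → List ℕ → Set
HasZeroSum m S = ∃[ U ] (U ⊆ S × U ≢ [] × ZeroSum m U)

module Correspondence (m : ℕ) .{{_ : NonZero m}} where

  open Congruence m

  InT⇒ : ∀ {a} → InT m a → ∃[ b ] (Coprime b m × ⟦ b ^ 3 ⟧ₙ ≡ ⟦ a ⟧ₙ)
  InT⇒ {a} (b , (_ , b⊥m) , eq) = b , b⊥m , sym (trans (cong ⟦_⟧ₙ (trans eq (mod≡% (b ^ 3) m))) (⟦⟧-% (b ^ 3)))

  ⇒InT : ∀ b → Coprime b m → ∃[ a ] (InT m a × ⟦ a ⟧ₙ ≡ ⟦ b ^ 3 ⟧ₙ)
  ⇒InT b b⊥m = ((b % m) ^ 3) mod m , (b % m , (m%n<n b m , Coprime-resp-⟦⟧ (sym (⟦⟧-% b)) b⊥m) , refl) , (begin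
    ⟦ ((b % m) ^ 3) mod m ⟧ₙ                  ≡⟨ cong ⟦_⟧ₙ (mod≡% ((b % m) ^ 3) m) ⟩
    ⟦ (b % m) ^ 3 % m ⟧ₙ                      ≡⟨ ⟦⟧-% ((b % m) ^ 3) ⟩
    ⟦ (b % m) ^ 3 ⟧ₙ                          ≡⟨ ⟦⟧-cube (b % m) ⟩
    ⟦ b % m ⟧ₙ * ⟦ b % m ⟧ₙ * ⟦ b % m ⟧ₙ      ≡⟨ cong (λ u → u * u * u) (⟦⟧-% b) ⟩
    ⟦ b ⟧ₙ * ⟦ b ⟧ₙ * ⟦ b ⟧ₙ                  ≡⟨ ⟦⟧-cube b ⟨
    ⟦ b ^ 3 ⟧ₙ                                ∎)
    where open ≡-Reasoning

  term-cong : ∀ {a b s t} x → ⟦ a ⟧ₙ ≡ ⟦ b ⟧ₙ → ⟦ s ⟧ₙ ≡ ⟦ t ⟧ₙ → ⟦ a ℕ.* x ℕ.+ s ⟧ₙ ≡ ⟦ b ℕ.* x ℕ.+ t ⟧ₙ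
  term-cong {a} {b} {s} {t} x a≡b s≡t = trans (⟦⟧-term a x s) (trans (cong₂ (λ u v → u * ⟦ x ⟧ₙ + v) a≡b s≡t) (sym (⟦⟧-term b x t)))

  Weighted⇒ : ∀ {U t} → Weighted m U t → ∃[ ws ] (length ws ≡ length U × All (InT m) ws × ⟦ sumₗ (zipWith ℕ._*_ ws U) ⟧ₙ ≡ ⟦ t ⟧ₙ)
  Weighted⇒ [] = [] , refl , [] , refl
  Weighted⇒ (cons {x} b b⊥m w refl) =
    let (a , a∈T , a≡b³)        = ⇒InT b b⊥m
        (ws , len , ws∈T , ≡t) = Weighted⇒ w
    in a ∷ ws , cong ℕ.suc len , a∈T ∷ ws∈T , term-cong x a≡b³ ≡t

  ⇒Weighted : ∀ ws U → length ws ≡ length U → All (InT m) ws → ∃[ t ] (Weighted m U t × ⟦ t ⟧ₙ ≡ ⟦ sumₗ (zipWith ℕ._*_ ws U) ⟧ₙ)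
  ⇒Weighted [] [] _ _ = 0 , [] , refl
  ⇒Weighted (a ∷ ws) (x ∷ U) len (a∈T ∷ ws∈T) =
    let (b , b⊥m , b³≡a) = InT⇒ a∈T
        (t , w , t≡)      = ⇒Weighted ws U (ℕ.suc-injective len) ws∈T
    in b ^ 3 ℕ.* x ℕ.+ t , cons b b⊥m w refl , term-cong x b³≡a t≡

  ZeroSum⇒WZeroSum : ∀ {U} → ZeroSum m U → WZeroSum m U
  ZeroSum⇒WZeroSum (t , w , m∣t) =
    let (ws , len , ws∈T , ≡t) = Weighted⇒ w
    in ws , len , ws∈T , trans (mod≡% _ m) (ℕ.n∣m⇒m%n≡0 _ m (⟦⟧≡⇒∣ (sym ≡t) m∣t))

  WZeroSum⇒ZeroSum : ∀ {U} → WZeroSum m U → ZeroSum m U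
  WZeroSum⇒ZeroSum {U} (ws , len , ws∈T , ≡0) =
    let (t , w , t≡) = ⇒Weighted ws U len ws∈T
    in t , w , ⟦⟧≡⇒∣ (sym t≡) (ℕ.m%n≡0⇒n∣m _ m (trans (sym (mod≡% _ m)) ≡0))

  HasZeroSum⇒HasWZSSub : ∀ {S} → HasZeroSum m S → HasWZSSub m S
  HasZeroSum⇒HasWZSSub (U , U⊆S , U≢[] , z) = U , U⊆S , U≢[] , ZeroSum⇒WZeroSum z

  HasWZSSub⇒HasZeroSum : ∀ {S} → HasWZSSub m S → HasZeroSum m S
  HasWZSSub⇒HasZeroSum (U , U⊆S , U≢[] , z) = U , U⊆S , U≢[] , WZeroSum⇒ZeroSum z

-- Zero-sum subsequences under permutation and multiplication by p

⊆-resp-↭ : ∀ {a} {A : Set a} {us xs ys : List A} → us ⊆ xs → xs ↭ ys → ∃[ vs ] (us ↭ vs × vs ⊆ ys)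
⊆-resp-↭ τ ↭.refl = _ , ↭-refl , τ
⊆-resp-↭ (_ ∷ʳ τ)   (↭.prep x σ) = let (vs , π , τ′) = ⊆-resp-↭ τ σ in vs , π , x ∷ʳ τ′
⊆-resp-↭ (refl ∷ τ) (↭.prep x σ) = let (vs , π , τ′) = ⊆-resp-↭ τ σ in x ∷ vs , ↭.prep x π , refl ∷ τ′
⊆-resp-↭ (_ ∷ʳ (_ ∷ʳ τ))     (↭.swap x y σ) = let (vs , π , τ′) = ⊆-resp-↭ τ σ in vs , π , y ∷ʳ (x ∷ʳ τ′)
⊆-resp-↭ (_ ∷ʳ (refl ∷ τ))   (↭.swap x y σ) = let (vs , π , τ′) = ⊆-resp-↭ τ σ in y ∷ vs , ↭.prep y π , refl ∷ (x ∷ʳ τ′)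
⊆-resp-↭ (refl ∷ (_ ∷ʳ τ))   (↭.swap x y σ) = let (vs , π , τ′) = ⊆-resp-↭ τ σ in x ∷ vs , ↭.prep x π , y ∷ʳ (refl ∷ τ′)
⊆-resp-↭ (refl ∷ (refl ∷ τ)) (↭.swap x y σ) = let (vs , π , τ′) = ⊆-resp-↭ τ σ in y ∷ x ∷ vs , ↭.swap x y π , refl ∷ (refl ∷ τ′)
⊆-resp-↭ τ (↭.trans σ₁ σ₂) =
  let (vs , π₁ , τ₁) = ⊆-resp-↭ τ σ₁
      (ws , π₂ , τ₂) = ⊆-resp-↭ τ₁ σ₂
  in ws , ↭-trans π₁ π₂ , τ₂

Weighted-resp-↭ : ∀ {m U V t} → Weighted m U t → U ↭ V → Weighted m V t
Weighted-resp-↭ w ↭.refl = w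
Weighted-resp-↭ (cons b b⊥m w eq) (↭.prep x σ) = cons b b⊥m (Weighted-resp-↭ w σ) eq
Weighted-resp-↭ (cons b b⊥m (cons c c⊥m w refl) refl) (↭.swap x y σ) =
  cons c c⊥m (cons b b⊥m (Weighted-resp-↭ w σ) refl) (solve 3 (λ a b c → a :+ (b :+ c) := b :+ (a :+ c)) refl (b ^ 3 ℕ.* x) (c ^ 3 ℕ.* y) _)
  where open ℕSolver
Weighted-resp-↭ w (↭.trans σ₁ σ₂) = Weighted-resp-↭ (Weighted-resp-↭ w σ₁) σ₂

HasZeroSum-resp-↭ : ∀ {m S S′} → S ↭ S′ → HasZeroSum m S → HasZeroSum m S′
HasZeroSum-resp-↭ σ (U , U⊆S , U≢[] , t , w , m∣t) =
  let (V , π , V⊆S′) = ⊆-resp-↭ U⊆S σ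
  in V , V⊆S′ , (λ V≡[] → U≢[] (↭.↭-empty-inv (subst (U ↭_) V≡[] π))) , t , Weighted-resp-↭ w π , m∣t

HasZeroSum-⊆ : ∀ {m S S′} → S ⊆ S′ → HasZeroSum m S → HasZeroSum m S′
HasZeroSum-⊆ τ (U , U⊆S , rest) = U , ⊆-trans U⊆S τ , rest

Weighted-map-* : ∀ {m U t} k → Weighted m U t → Weighted m (map (k ℕ.*_) U) (k ℕ.* t)
Weighted-map-* {m} k [] = subst (Weighted m []) (sym (ℕ.*-zeroʳ k)) []
Weighted-map-* k (cons {x} {t = t} b b⊥m w refl) = cons b b⊥m (Weighted-map-* k w)
  (solve 4 (λ k c x t → k :* (c :* x :+ t) := c :* (k :* x) :+ k :* t) refl k (b ^ 3) x t)
  where open ℕSolver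

-- The roots are only coprime to n. They are replaced by roots congruent to them mod n and to 1 mod
-- p, hence coprime to p n.
Weighted-extend : ∀ p {n U t} .{{_ : NonZero p}} .{{_ : NonZero n}} → Coprime p n → Weighted n U t → n ∣ t →
                  ∃[ r ] (Weighted (p ℕ.* n) U r × n ∣ r)
Weighted-extend p {n} {U} p⊥n w n∣t =
  let (r , wr , _ , r≡t) = ChineseRemainder.Weighted-crt p n p⊥n (proj₂ (Weighted-all-ones p U)) w
  in r , wr , Congruence.⟦⟧≡⇒∣ n (sym r≡t) n∣t

HasZeroSum-map-* : ∀ p {n S} .{{_ : NonZero p}} .{{_ : NonZero n}} → Coprime p n → HasZeroSum n S → HasZeroSum (p ℕ.* n) (map (p ℕ.*_) S)
HasZeroSum-map-* p p⊥n (U , U⊆S , U≢[] , t , w , n∣t) =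
  let (r , wr , n∣r) = Weighted-extend p p⊥n w n∣t
  in map (p ℕ.*_) U , map⁺ (p ℕ.*_) U⊆S , U≢[] ∘ map≡[] , p ℕ.* r , Weighted-map-* p wr , ℕ.*-monoʳ-∣ p n∣r
  where
  map≡[] : ∀ {U : List ℕ} → map (p ℕ.*_) U ≡ [] → U ≡ []
  map≡[] {[]} _ = refl

-- Putting the terms prime to p in front gives the list the shape that both cases of the theorem ask
-- for.
separate : ∀ p S → ∃[ Y ] S ↭ nondivisible p S ++ map (p ℕ.*_) Y
separate p [] = [] , ↭-refl
separate p (x ∷ S) with p ∣? x | separate p S
... | no _                 | Y , σ = Y , ↭-prep x σ
... | yes (ℕ.divides q eq) | Y , σ rewrite trans eq (ℕ.*-comm q p) = q ∷ Y , ↭-trans (↭-prep _ σ) (↭-sym (shift (p ℕ.* q) (nondivisible p S) (map (p ℕ.*_) Y)))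

-- Induction on the primes dividing n

SquareFree-∣ : ∀ {m n} → m ∣ n → SquareFree n → SquareFree m
SquareFree-∣ m∣n sf p p-prime p²∣m = sf p p-prime (ℕ.∣-trans p²∣m m∣n)

SquareFree⇒Coprime : ∀ {p n} → Prime p → SquareFree (p ℕ.* n) → Coprime p n
SquareFree⇒Coprime {p} p-prime sf = Coprime.sym (prime∤⇒Coprime p-prime λ p∣n → sf p p-prime (ℕ.*-monoʳ-∣ p p∣n))

-- A pair (p , k) in which k plays the role of D_{T_p}(ℤ_p) − 1.
Factor : ℕ × ℕ → Set
Factor (p , k) = Prime p × (∀ S → k < length (nondivisible p S) → ZeroSum p S)

-- A list of pairs (p , 2) and (p , 1) encodes n together with 2 Ω(n₁) + Ω(n₂), so that both kinds
-- of primes are handled by one induction.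
modulus bound : List (ℕ × ℕ) → ℕ
modulus L = product (map proj₁ L)
bound L = sumₗ (map proj₂ L)

modulus≢0 : ∀ {L} → All Factor L → NonZero (modulus L)
modulus≢0 fs = productOfPrimes≢0 (All.map⁺ (All.map proj₁ fs))

ZeroSum-modulus : ∀ L S → All Factor L → SquareFree (modulus L) → All (λ (p , k) → k < length (nondivisible p S)) L → ZeroSum (modulus L) S
ZeroSum-modulus [] S _ _ _ = let (t , w) = Weighted-all-ones 1 S in t , w , ℕ.1∣ t
ZeroSum-modulus ((p , k) ∷ L) S ((p-prime , zs) ∷ fs) sf (h ∷ hs) =
  ChineseRemainder.ZeroSum-crt p (modulus L) {{prime⇒nonZero p-prime}} {{modulus≢0 fs}} (SquareFree⇒Coprime p-prime sf)
    (zs S h) (ZeroSum-modulus L S fs (SquareFree-∣ (ℕ.n∣m*n p) sf) hs)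

-- The membership proof is kept next to the permutation because it later decides between the two
-- cases of the theorem.
few-nondivisible? : ∀ L S → (∃[ e ] ∃[ L′ ] (e ∈ L × L ↭ e ∷ L′ × length (nondivisible (proj₁ e) S) ≤ proj₂ e))
                            ⊎ All (λ (p , k) → k < length (nondivisible p S)) L
few-nondivisible? L S = case Any.any? (λ e → length (nondivisible (proj₁ e) S) ℕ.≤? proj₂ e) L of λ where
  (no ¬any) → inj₂ (All.map ℕ.≰⇒> (All.¬Any⇒All¬ L ¬any))
  (yes any) → inj₁ (let (e , e∈L , h)        = find any
                        (xs , ys , L≡) = ∈-∃++ e∈L
                    in e , xs ++ ys , e∈L , subst (_↭ e ∷ xs ++ ys) (sym L≡) (shift e xs ys) , h)

modulus-↭ : ∀ {L L′} → L ↭ L′ → modulus L ≡ modulus L′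
modulus-↭ σ = product-↭ (↭.map⁺ proj₁ σ)

bound-↭ : ∀ {L L′} → L ↭ L′ → bound L ≡ bound L′
bound-↭ σ = sum-↭ (↭.map⁺ proj₂ σ)

separate-length : ∀ p S → length S ≡ length (nondivisible p S) ℕ.+ length (proj₁ (separate p S))
separate-length p S = let (Y , σ) = separate p S in
  trans (↭-length σ) (trans (length-++ (nondivisible p S)) (cong (length (nondivisible p S) ℕ.+_) (length-map (p ℕ.*_) Y)))

-- D_{T_n}(ℤ_n) ≤ 2 Ω(n₁) + Ω(n₂) + 1.
long⇒HasZeroSum : ∀ k L → length L ≡ k → All Factor L → SquareFree (modulus L) → ∀ S → bound L < length S → HasZeroSum (modulus L) S
long⇒HasZeroSum k L len fs sf S h = case few-nondivisible? L S of λ where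
    (inj₂ all) → S , ⊆-refl , (λ { refl → ℕ.<⇒≱ h z≤n }) , ZeroSum-modulus L S fs sf all
    (inj₁ ((p , j) , L′ , _ , σ , nd≤j)) → descend k len p j L′ σ nd≤j
  where
  -- Passing to the multiples of p loses at most j terms, and the bound drops by exactly j, so the
  -- quotient sequence is still too long.
  descend : ∀ k → length L ≡ k → ∀ p j L′ → L ↭ (p , j) ∷ L′ → length (nondivisible p S) ≤ j → HasZeroSum (modulus L) S
  descend ℕ.zero    len p j L′ σ nd≤j = contradiction (trans (sym (↭-length σ)) len) λ ()
  descend (ℕ.suc k) len p j L′ σ nd≤j with All-resp-↭ σ fs
  ... | (p-prime , _) ∷ fs′ = subst (λ n → HasZeroSum n S) (sym (modulus-↭ σ))
      (HasZeroSum-resp-↭ (↭-sym (proj₂ (separate p S))) (HasZeroSum-⊆ (++⁺ˡ (nondivisible p S) ⊆-refl)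
        (HasZeroSum-map-* p {{prime⇒nonZero p-prime}} {{modulus≢0 fs′}} (SquareFree⇒Coprime p-prime sf′)
          (long⇒HasZeroSum k L′ (ℕ.suc-injective (trans (sym (↭-length σ)) len)) fs′ (SquareFree-∣ (ℕ.n∣m*n p) sf′) Y long))))
    where
    Y = proj₁ (separate p S)
    sf′ : SquareFree (p ℕ.* modulus L′)
    sf′ = subst SquareFree (modulus-↭ σ) sf
    long : bound L′ < length Y
    long = ℕ.+-cancelˡ-< j (bound L′) (length Y) (begin-strict
      j ℕ.+ bound L′                             ≡⟨ bound-↭ σ ⟨
      bound L                                    <⟨ h ⟩
      length S                                   ≡⟨ separate-length p S ⟩
      length (nondivisible p S) ℕ.+ length Y     ≤⟨ ℕ.+-monoˡ-≤ (length Y) nd≤j ⟩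
      j ℕ.+ length Y                             ∎)
      where open ℕ.≤-Reasoning

-- The lower bound for the Davenport constant comes for free: the initial segments of Y have no zero-sum subsequence.
extremal : ∀ {n} L → n ≡ modulus L → All Factor L → SquareFree n → ∀ Y → SeqOver n Y → ¬ HasZeroSum n Y → length Y ≡ bound L → Extremal n Y
extremal L refl fs sf Y Y<n ¬zs len = Y<n , ¬zs ∘ HasWZSSub⇒HasZeroSum , ℕ.suc (length Y) ,
    (s≤s z≤n , (λ S _ lenS → HasZeroSum⇒HasWZSSub (long⇒HasZeroSum _ L refl fs sf S (ℕ.≤-reflexive (trans (cong ℕ.suc (sym len)) (sym lenS))))) ,
     (λ k _ k≤len → take k Y , All.take⁺ k Y<n , trans (length-take k Y) (ℕ.m≤n⇒m⊓n≡m (ℕ.s≤s⁻¹ k≤len)) ,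
        ¬zs ∘ HasZeroSum-⊆ (take-⊆ k Y) ∘ HasWZSSub⇒HasZeroSum)) ,
    refl
  where
  instance
    n≢0 : NonZero (modulus L)
    n≢0 = modulus≢0 fs
  open Correspondence (modulus L)

-- Lifting weights for x₁ x₂ from ℤ_p to ℤ_n merges x₁ and x₂ into one term p y, and y ∷ Y is too long for ℤ_n′.
merge-pair : ∀ p n {t x₁ x₂} Y .{{_ : NonZero p}} .{{_ : NonZero n}} → Coprime p n → Weighted p (x₁ ∷ x₂ ∷ []) t → p ∣ t →
             (∀ y → HasZeroSum n (y ∷ Y)) → HasZeroSum (p ℕ.* n) (x₁ ∷ x₂ ∷ map (p ℕ.*_) Y)
merge-pair p n {t} {x₁} {x₂} Y p⊥n w p∣t zs =
    case ChineseRemainder.Weighted-crt p n p⊥n w (proj₂ (Weighted-all-ones n (x₁ ∷ x₂ ∷ []))) of λ where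
      (_ , cons a₁ a₁⊥ (cons a₂ a₂⊥ [] refl) refl , r≡t , _) →
        combine a₁ a₁⊥ a₂ a₂⊥ (Congruence.⟦⟧≡⇒∣ p (sym r≡t) p∣t)
  where
  combine : ∀ a₁ → Coprime a₁ (p ℕ.* n) → ∀ a₂ → Coprime a₂ (p ℕ.* n) →
            p ∣ a₁ ^ 3 ℕ.* x₁ ℕ.+ (a₂ ^ 3 ℕ.* x₂ ℕ.+ 0) → HasZeroSum (p ℕ.* n) (x₁ ∷ x₂ ∷ map (p ℕ.*_) Y)
  combine a₁ a₁⊥ a₂ a₂⊥ (ℕ.divides y eq) = case zs y of λ where
      (U , (_ ∷ʳ U⊆Y) , U≢[] , z) → HasZeroSum-⊆ (x₁ ∷ʳ (x₂ ∷ʳ ⊆-refl)) (HasZeroSum-map-* p p⊥n (U , U⊆Y , U≢[] , z))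
      -- If y is used, p y is written as a₁³ x₁ + a₂³ x₂, so the root c of its weight multiplies
      -- both a₁ and a₂.
      (_ ∷ U , (refl ∷ U⊆Y) , _ , s , ws , n∣s) → case Weighted-extend p p⊥n ws n∣s of λ where
        (_ , cons {t = r} c c⊥ wr refl , n∣) → x₁ ∷ x₂ ∷ map (p ℕ.*_) U , refl ∷ (refl ∷ map⁺ (p ℕ.*_) U⊆Y) , (λ ()) ,
          p ℕ.* (c ^ 3 ℕ.* y ℕ.+ r) ,
          cons (c ℕ.* a₁) (Coprime-*ˡ c⊥ a₁⊥) (cons (c ℕ.* a₂) (Coprime-*ˡ c⊥ a₂⊥) (Weighted-map-* p wr) refl) (expand c r) ,
          ℕ.*-monoʳ-∣ p n∣
    where
    open ≡-Reasoning
    open ℕSolver using (solve; _:=_; _:+_; _:*_; _:^_; con)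
    expand : ∀ c r → p ℕ.* (c ^ 3 ℕ.* y ℕ.+ r) ≡ (c ℕ.* a₁) ^ 3 ℕ.* x₁ ℕ.+ ((c ℕ.* a₂) ^ 3 ℕ.* x₂ ℕ.+ p ℕ.* r)
    expand c r = begin
      p ℕ.* (c ^ 3 ℕ.* y ℕ.+ r)
        ≡⟨ solve 4 (λ p c y r → p :* (c :^ 3 :* y :+ r) := c :^ 3 :* (y :* p) :+ p :* r) refl p c y r ⟩
      c ^ 3 ℕ.* (y ℕ.* p) ℕ.+ p ℕ.* r
        ≡⟨ cong (λ z → c ^ 3 ℕ.* z ℕ.+ p ℕ.* r) eq ⟨
      c ^ 3 ℕ.* (a₁ ^ 3 ℕ.* x₁ ℕ.+ (a₂ ^ 3 ℕ.* x₂ ℕ.+ 0)) ℕ.+ p ℕ.* r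
        ≡⟨ solve 6 (λ c a₁ a₂ x₁ x₂ q → c :^ 3 :* (a₁ :^ 3 :* x₁ :+ (a₂ :^ 3 :* x₂ :+ con 0)) :+ q
             := (c :* a₁) :^ 3 :* x₁ :+ ((c :* a₂) :^ 3 :* x₂ :+ q)) refl c a₁ a₂ x₁ x₂ (p ℕ.* r) ⟩
      (c ℕ.* a₁) ^ 3 ℕ.* x₁ ℕ.+ ((c ℕ.* a₂) ^ 3 ℕ.* x₂ ℕ.+ p ℕ.* r) ∎

¬ZeroSum-singleton : ∀ {p x} → Prime p → ¬ p ∣ x → ¬ ZeroSum p (x ∷ [])
¬ZeroSum-singleton {p} {x} p-prime p∤x (_ , cons b b⊥p [] refl , p∣) =
  p∤x (coprime-divisor (Coprime.sym (Coprime-*ˡ b⊥p (Coprime-*ˡ b⊥p (Coprime-*ˡ b⊥p (Coprime.1-coprimeTo p)))))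
        (subst (p ∣_) (ℕ.+-identityʳ _) p∣))

¬HasZeroSum-pair : ∀ {p x₁ x₂} → Prime p → ¬ p ∣ x₁ → ¬ p ∣ x₂ → ¬ ZeroSum p (x₁ ∷ x₂ ∷ []) → ¬ HasZeroSum p (x₁ ∷ x₂ ∷ [])
¬HasZeroSum-pair p-prime p∤x₁ p∤x₂ ¬z = λ where
  (_ , (_ ∷ʳ (_ ∷ʳ []))       , U≢[] , _) → U≢[] refl
  (_ , (refl ∷ (_ ∷ʳ []))     , _ , z)    → ¬ZeroSum-singleton p-prime p∤x₁ z
  (_ , (_ ∷ʳ (refl ∷ []))     , _ , z)    → ¬ZeroSum-singleton p-prime p∤x₂ z
  (_ , (refl ∷ (refl ∷ []))   , _ , z)    → ¬z z

Weighted-% : ∀ p .{{_ : NonZero p}} {S t} → Weighted p (map (_% p) S) t → ∃[ s ] (Weighted p S s × Congruence.⟦_⟧ₙ p s ≡ Congruence.⟦_⟧ₙ p t)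
Weighted-% p {[]} [] = 0 , [] , refl
Weighted-% p {x ∷ S} (cons {t = t} b b⊥p w refl) =
  let (s , w′ , s≡t) = Weighted-% p w in
  b ^ 3 ℕ.* x ℕ.+ s , cons b b⊥p w′ refl ,
  trans (⟦⟧-term (b ^ 3) x s) (trans (cong₂ (λ u v → ⟦ b ^ 3 ⟧ₙ * u + v) (sym (⟦⟧-% x)) s≡t) (sym (⟦⟧-term (b ^ 3) (x % p) t)))
  where open Congruence p

-- Reordering is the only change made to S, so c = 1 and all weights 1 are taken; 1 < n makes 1 a
-- reduced residue.
EquivT-↭ : ∀ {n S xs} → 1 < n → SeqOver n xs → S ↭ xs → EquivT n S xs
EquivT-↭ {n} {S} {xs} 1<n xs<n σ = 1 , unit , xs , σ , pointwise xs<n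
  where
  instance
    n≢0 : NonZero n
    n≢0 = ℕ.>-nonZero (ℕ.<-trans (s≤s z≤n) 1<n)
  unit : Unit n 1
  unit = 1<n , Coprime.1-coprimeTo n
  reduced : ∀ {z} → z < n → z ≡ z mod n
  reduced {z} z<n = sym (trans (mod≡% z n) (m<n⇒m%n≡m z<n))
  pointwise : ∀ {xs} → SeqOver n xs → Pointwise (λ z y → ∃[ a ] (InT n a × y ≡ (1 ℕ.* a ℕ.* z) mod n)) xs xs
  pointwise [] = []
  pointwise {z ∷ _} (z<n ∷ xs<n) =
    (1 , (1 , unit , reduced 1<n) , trans (reduced z<n) (cong (_mod n) (sym (ℕ.*-identityˡ z)))) ∷ pointwise xs<n

-- Splitting one prime off a sequence of maximal length

module Reduction (p k : ℕ) (L : List (ℕ × ℕ)) (factor : Factor (p , k)) (fs : All Factor L) (n : ℕ) (n≡ : n ≡ p ℕ.* modulus L)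
  (sf : SquareFree n) (S : List ℕ) (S<n : SeqOver n S) (len : length S ≡ k ℕ.+ bound L) (¬zs : ¬ HasZeroSum n S)
  (few : length (nondivisible p S) ≤ k) where

  n′ : ℕ
  n′ = modulus L

  p-prime : Prime p
  p-prime = proj₁ factor

  instance
    p≢0 : NonZero p
    p≢0 = prime⇒nonZero p-prime
    n′≢0 : NonZero n′
    n′≢0 = modulus≢0 fs

  N Y : List ℕ
  N = nondivisible p S
  Y = proj₁ (separate p S)

  S↭ : S ↭ N ++ map (p ℕ.*_) Y
  S↭ = proj₂ (separate p S)

  p⊥n′ : Coprime p n′
  p⊥n′ = SquareFree⇒Coprime p-prime (subst SquareFree n≡ sf)

  sf′ : SquareFree n′
  sf′ = SquareFree-∣ (ℕ.divides p n≡) sf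

  ¬zs-split : ¬ HasZeroSum (p ℕ.* n′) (N ++ map (p ℕ.*_) Y)
  ¬zs-split z = ¬zs (subst (λ n → HasZeroSum n S) (sym n≡) (HasZeroSum-resp-↭ (↭-sym S↭) z))

  ¬zs-Y : ¬ HasZeroSum n′ Y
  ¬zs-Y z = ¬zs-split (HasZeroSum-⊆ (++⁺ˡ N ⊆-refl) (HasZeroSum-map-* p p⊥n′ z))

  |Y|≤ : length Y ≤ bound L
  |Y|≤ = ℕ.≮⇒≥ (λ long → ¬zs-Y (long⇒HasZeroSum _ L refl fs sf′ Y long))

  |N|+|Y| : length N ℕ.+ length Y ≡ k ℕ.+ bound L
  |N|+|Y| = trans (sym (separate-length p S)) len

  -- The lengths of N and Y are at most k and `bound L` and add up to k + `bound L`, so neither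
  -- bound has slack.
  |N|≡k : length N ≡ k
  |N|≡k = ℕ.≤-antisym few (ℕ.+-cancelʳ-≤ (bound L) k (length N)
    (ℕ.≤-trans (ℕ.≤-reflexive (sym |N|+|Y|)) (ℕ.+-monoʳ-≤ (length N) |Y|≤)))

  |Y|≡ : length Y ≡ bound L
  |Y|≡ = ℕ.+-cancelˡ-≡ k _ _ (trans (cong (ℕ._+ length Y) (sym |N|≡k)) |N|+|Y|)

  xs<n : SeqOver n (N ++ map (p ℕ.*_) Y)
  xs<n = All-resp-↭ S↭ S<n

  Y<n′ : SeqOver n′ Y
  Y<n′ = All.map (λ {y} py<n → ℕ.*-cancelˡ-< p y n′ (subst (p ℕ.* y <_) n≡ py<n)) (All.map⁻ (All.++⁻ʳ N xs<n))

  Y-extremal : Extremal n′ Y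
  Y-extremal = extremal L refl fs sf′ Y Y<n′ ¬zs-Y |Y|≡

  p∣rest : All (p ∣_) (map (p ℕ.*_) Y)
  p∣rest = All.map⁺ (All.universal (ℕ.m∣m*n {p}) Y)

  p∤N : All (λ x → ¬ p ∣ x) N
  p∤N = All.all-filter (λ x → ¬? (p ∣? x)) S

  -- `extremal` for the one-prime list (p , 2). A weighted zero-sum of the pair mod p would let
  -- `merge-pair` trade two terms for one, producing a sequence over ℤ_n′ one longer than `bound L`.
  pair-extremal : ∀ {x₁ x₂} → k ≡ 2 → N ≡ x₁ ∷ x₂ ∷ [] → Extremal p (x₁ mod p ∷ x₂ mod p ∷ [])
  pair-extremal {x₁} {x₂} refl N≡ = subst₂ (λ y₁ y₂ → Extremal p (y₁ ∷ y₂ ∷ [])) (sym (mod≡% x₁ p)) (sym (mod≡% x₂ p))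
      (extremal ((p , 2) ∷ []) (sym (ℕ.*-identityʳ p)) (factor ∷ []) (SquareFree-∣ p∣n sf) _ (m%n<n x₁ p ∷ m%n<n x₂ p ∷ []) ¬pair refl)
    where
    p∣n : p ∣ n
    p∣n = ℕ.divides n′ (trans n≡ (ℕ.*-comm p n′))
    p∤% : ∀ {x} → ¬ p ∣ x → ¬ p ∣ x % p
    p∤% {x} p∤x p∣x% = p∤x (Congruence.⟦⟧≡⇒∣ p (Congruence.⟦⟧-% p x) p∣x%)
    ¬zero-sum : ¬ ZeroSum p (x₁ % p ∷ x₂ % p ∷ [])
    ¬zero-sum (t , w , p∣t) =
      let (s , w′ , s≡t) = Weighted-% p {x₁ ∷ x₂ ∷ []} w in
      ¬zs-split (subst (λ N → HasZeroSum (p ℕ.* n′) (N ++ map (p ℕ.*_) Y)) (sym N≡)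
        (merge-pair p n′ Y p⊥n′ w′ (Congruence.⟦⟧≡⇒∣ p (sym s≡t) p∣t)
          (λ y → long⇒HasZeroSum _ L refl fs sf′ (y ∷ Y) (s≤s (ℕ.≤-reflexive (sym |Y|≡))))))
    ¬pair : ¬ HasZeroSum p (x₁ % p ∷ x₂ % p ∷ [])
    ¬pair = case subst (All (λ x → ¬ p ∣ x)) N≡ p∤N of λ where
      (p∤x₁ ∷ p∤x₂ ∷ []) → ¬HasZeroSum-pair p-prime (p∤% p∤x₁) (p∤% p∤x₂) ¬zero-sum

  case₁ : ∀ {n₁} → k ≡ 2 → p ∣ n₁ → Case1 n n₁ (N ++ map (p ℕ.*_) Y)
  case₁ k≡2 p∣n₁ = from-length N refl (trans |N|≡k k≡2)
    where
    from-length : ∀ M → N ≡ M → length M ≡ 2 → Case1 n _ (N ++ map (p ℕ.*_) Y)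
    from-length (x₁ ∷ x₂ ∷ []) N≡ _ = case subst (All (λ x → ¬ p ∣ x)) N≡ p∤N of λ where
      (p∤x₁ ∷ p∤x₂ ∷ []) → p , p-prime , p∣n₁ , n′ , n≡ , x₁ , x₂ , map (p ℕ.*_) Y , cong (_++ map (p ℕ.*_) Y) N≡ ,
        p∤x₁ , p∤x₂ , p∣rest , Y , (refl , Y-extremal) , pair-extremal k≡2 N≡

  case₂ : ∀ {n₂} → k ≡ 1 → p ∣ n₂ → Case2 n n₂ (N ++ map (p ℕ.*_) Y)
  case₂ k≡1 p∣n₂ = from-length N refl (trans |N|≡k k≡1)
    where
    from-length : ∀ M → N ≡ M → length M ≡ 1 → Case2 n _ (N ++ map (p ℕ.*_) Y)
    from-length (x₁ ∷ []) N≡ _ = case subst (All (λ x → ¬ p ∣ x)) N≡ p∤N of λ where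
      (p∤x₁ ∷ []) → p , p-prime , p∣n₂ , n′ , n≡ , x₁ , map (p ℕ.*_) Y , cong (_++ map (p ℕ.*_) Y) N≡ ,
        p∤x₁ , p∣rest , Y , refl , Y-extremal

odd-prime∤2 : ∀ {p} → Prime p → ¬ 2 ∣ p → ¬ p ∣ 2
odd-prime∤2 {p} p-prime 2∤p p∣2 = case irreducible[2] p∣2 of λ where
  (inj₁ refl) → ¬prime[1] p-prime
  (inj₂ refl) → 2∤p ℕ.∣-refl

-- Assembly of the theorem

open import Data.Nat using (_+_; _*_)

theorem1p2 : (n : ℕ) (ps qs : List ℕ) →
    All (λ p → Prime p × p mod 3 ≡ 1) ps →
    All (λ q → Prime q × q mod 3 ≡ 2) qs →
    n ≡ product ps * product qs →
    1 < n → SquareFree n → ¬ (2 ∣ n) → ¬ (7 ∣ n) → ¬ (13 ∣ n) →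
    (S : List ℕ) → SeqOver n S →
    length S ≡ 2 * length ps + length qs →
    ¬ HasWZSSub n S →
    ∃[ xs ] (EquivT n S xs × (Case1 n (product ps) xs ⊎ Case2 n (product qs) xs))
theorem1p2 n ps qs ps-prime qs-prime n≡ 1<n sf 2∤n 7∤n 13∤n S S<n len ¬zs =
    case few-nondivisible? L S of λ where
      -- If no prime has few terms prime to it, all of S is a weighted zero-sum modulo every prime,
      -- hence modulo n.
      (inj₂ all) → contradiction (S , ⊆-refl , S≢[] , subst (λ n → ZeroSum n S) (sym n≡L) (ZeroSum-modulus L S L-factors (subst SquareFree n≡L sf) all)) ¬zs′
      (inj₁ ((p , k) , L′ , e∈L , σ , few)) → case All-resp-↭ σ L-factors of λ where
        (factor ∷ fs) →
          let module R = Reduction p k L′ factor fs n (trans n≡L (modulus-↭ σ)) sf S S<n (trans len (trans (sym L-bound) (bound-↭ σ))) ¬zs′ few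
          -- The tag 2 or 1 of the chosen pair tells whether p divides n₁ or n₂, and so which case
          -- arises.
          in R.N ++ map (p *_) R.Y , EquivT-↭ 1<n R.xs<n R.S↭ , (case ∈-++⁻ (tag 2 ps) e∈L of λ where
            (inj₁ ∈ps) → case ∈-map⁻ (_, 2) ∈ps of λ where (_ , p∈ps , refl) → inj₁ (R.case₁ refl (∈⇒∣product p∈ps))
            (inj₂ ∈qs) → case ∈-map⁻ (_, 1) ∈qs of λ where (_ , q∈qs , refl) → inj₂ (R.case₂ refl (∈⇒∣product q∈qs)))
  where
  instance
    n≢0 : NonZero n
    n≢0 = ℕ.>-nonZero (ℕ.<-trans (s≤s z≤n) 1<n)

  tag : ℕ → List ℕ → List (ℕ × ℕ)
  tag k = map (_, k)

  L : List (ℕ × ℕ)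
  L = tag 2 ps ++ tag 1 qs

  ¬zs′ : ¬ HasZeroSum n S
  ¬zs′ = ¬zs ∘ Correspondence.HasZeroSum⇒HasWZSSub n

  map-proj₁ : ∀ k xs → map proj₁ (tag k xs) ≡ xs
  map-proj₁ k xs = trans (sym (map-∘ xs)) (map-id xs)

  L-modulus : modulus L ≡ product ps * product qs
  L-modulus = trans (cong product (trans (map-++ proj₁ (tag 2 ps) (tag 1 qs)) (cong₂ _++_ (map-proj₁ 2 ps) (map-proj₁ 1 qs)))) (product-++ ps qs)

  n≡L : n ≡ modulus L
  n≡L = trans n≡ (sym L-modulus)

  sum-const : ∀ k xs → bound (tag k xs) ≡ k * length xs
  sum-const k []       = sym (ℕ.*-zeroʳ k)
  sum-const k (x ∷ xs) = trans (cong (k +_) (sum-const k xs)) (sym (ℕ.*-suc k (length xs)))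

  L-bound : bound L ≡ 2 * length ps + length qs
  L-bound = trans (cong sumₗ (map-++ proj₂ (tag 2 ps) (tag 1 qs)))
    (trans (sum-++ (map proj₂ (tag 2 ps)) (map proj₂ (tag 1 qs)))
      (cong₂ _+_ (sum-const 2 ps) (trans (sum-const 1 qs) (ℕ.+-identityʳ (length qs)))))

  ps∣n : ∀ {p} → p ∈ ps → p ∣ n
  ps∣n p∈ps = ℕ.∣-trans (∈⇒∣product p∈ps) (subst (product ps ∣_) (sym n≡) (ℕ.m∣m*n (product qs)))

  qs∣n : ∀ {q} → q ∈ qs → q ∣ n
  qs∣n q∈qs = ℕ.∣-trans (∈⇒∣product q∈qs) (subst (product qs ∣_) (sym n≡) (ℕ.n∣m*n (product ps)))

  L-factors : All Factor L
  L-factors = All.++⁺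
    (All.map⁺ (All.tabulate λ {p} p∈ps → let (p-prime , _) = All.lookup ps-prime p∈ps in p-prime ,
      Threshold.zero-sum₃ p p-prime (odd-prime∤2 p-prime (2∤n ∘ λ 2∣p → ℕ.∣-trans 2∣p (ps∣n p∈ps)))
        (λ d → 2∤n (ℕ.∣-trans d (ps∣n p∈ps))) (λ d → 7∤n (ℕ.∣-trans d (ps∣n p∈ps))) (λ d → 13∤n (ℕ.∣-trans d (ps∣n p∈ps)))))
    (All.map⁺ (All.tabulate λ {q} q∈qs → let (q-prime , q%3≡2) = All.lookup qs-prime q∈qs in q-prime ,
      Threshold.zero-sum₂ q q-prime (odd-prime∤2 q-prime (λ d → 2∤n (ℕ.∣-trans d (qs∣n q∈qs)))) q%3≡2))

  -- An empty S has length 0, so there are no primes at all and n = 1.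
  S≢[] : S ≢ []
  S≢[] S≡[] = ℕ.<⇒≢ 1<n (sym (trans n≡ (cong₂ _*_ (product≡1 ps ps-empty) (product≡1 qs qs-empty))))
    where
    product≡1 : ∀ xs → length xs ≡ 0 → product xs ≡ 1
    product≡1 [] _ = refl
    total≡0 : 2 * length ps + length qs ≡ 0
    total≡0 = trans (sym len) (cong length S≡[])
    ps-empty : length ps ≡ 0
    ps-empty = ℕ.m+n≡0⇒m≡0 (length ps) (ℕ.m+n≡0⇒m≡0 (2 * length ps) total≡0)
    qs-empty : length qs ≡ 0
    qs-empty = ℕ.m+n≡0⇒n≡0 (2 * length ps) total≡0
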